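{- For any constant $p\in(0,1)$ and any (fixed) graph $F$ with at least one edge, with high probability, $$\mathrm{sat}\big(\mathbb{G}(n,p),F\big)\geqslant\frac{w(F)-1}{2}n-O(\log n).$$
   Context: All graphs are finite, undirected, without loops or multiple edges. For a graph $F$, $w(F)=\min_{xy\in E(F)}\big\{\max\{d(x),d(y)\}+|N(x)\cap N(y)|\big\}$, where $d(x)$ and $N(x)$ are the degree and the neighborhood of $x$ in $F$. For graphs $G$ and $F$, a graph is $F$-free if it has no subgraph (not necessarily induced) isomorphic to $F$. A spanning subgraph $H$ of $G$ is an $F$-saturated subgraph of $G$ if $H$ is $F$-free and adding any edge of $E(G)\setminus E(H)$ to $H$ creates a copy of $F$. $\mathrm{sat}(G,F)$ denotes the minimum number of edges in an $F$-saturated subgraph of $G$. $\mathbb{G}(n,p)$ is the Erdős–Rényi random graph on a fixed vertex set of size $n$, where every two distinct vertices are adjacent independently with probability $p$. "With high probability" means with probability tending to $1$ as $n\to\infty$. The implied constant in $O(\log n)$ depends only on $p$ and $F$. -}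

module Defs where

open import Data.Bool.Base using (Bool; true; false; T; if_then_else_)
open import Data.Bool.Properties using (T?)
open import Data.Empty using (⊥-elim)
open import Data.Fin.Base using (Fin; zero; suc)
open import Data.Fin.Properties using (any?; all?) renaming (_≟_ to _≟ᶠ_)
import Data.Fin.Subset as Subset
open Subset using (Subset; _∩_; ∣_∣)
open import Data.Fin.Subset.Properties using (∣p∣≤n)
open import Data.Integer.Base as ℤ using (ℤ)
open import Data.List.Base
  using (List; []; _∷_; map; filter; foldr; allFin; cartesianProduct; cartesianProductWith)
open import Data.List.Extrema.Nat using (min; argmin-sel; min≤xs)
open import Data.List.Membership.Propositional using (_∈_)
open import Data.List.Membership.Propositional.Properties
  using (∈-map⁺; ∈-map⁻; ∈-filter⁺; ∈-filter⁻; ∈-allFin; ∈-cartesianProduct⁺;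
         ∈-cartesianProductWith⁺; ∈-++⁺ʳ)
open import Data.List.Relation.Unary.Any using (here)
import Data.List.Relation.Unary.All as All
open import Data.Nat.Base as ℕ using (ℕ; zero; suc)
import Data.Nat.Properties as ℕ
open import Data.Product.Base using (∃; ∃₂; _×_; _,_; proj₁; proj₂; uncurry)
open import Data.Rational.Base as ℚ using (ℚ; 0ℚ; 1ℚ; ½; 1/_)
import Data.Rational.Properties as ℚ
open import Data.Rational.Solver using (module +-*-Solver)
open import Data.Sum.Base using (inj₁; inj₂)
open import Data.Vec.Base as Vec using (Vec; []; _∷_; lookup; tabulate; _[_]≔_)
import Data.Vec.Functional as Fun
open import Function.Base using (_∘_; id)
open import Function.Definitions using (Injective)
open import Relation.Binary.PropositionalEquality
open import Relation.Nullary using (¬_; Dec; yes; no)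
open import Relation.Nullary.Decidable using (map′; _×-dec_; _→-dec_; ¬?)
open import Relation.Unary using (Decidable)

private
  variable
    k n : ℕ

record ℝ : Set where
  constructor mkℝ
  field
    seq    : ℕ → ℚ
    cauchy : ∀ ε → 0ℚ ℚ.< ε →
             ∃ λ N → ∀ i j → N ℕ.≤ i → N ℕ.≤ j → ℚ.∣ seq i ℚ.- seq j ∣ ℚ.< ε

open ℝ public

private
  half-pos : ∀ {ε} → 0ℚ ℚ.< ε → 0ℚ ℚ.< ½ ℚ.* ε
  half-pos {ε} 0<ε = subst (ℚ._< ½ ℚ.* ε) (ℚ.*-zeroʳ ½) (ℚ.*-monoʳ-<-pos ½ 0<ε)

  halves : ∀ ε → ½ ℚ.* ε ℚ.+ ½ ℚ.* ε ≡ ε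
  halves ε = begin
    ½ ℚ.* ε ℚ.+ ½ ℚ.* ε  ≡⟨ ℚ.*-distribʳ-+ ε ½ ½ ⟨
    1ℚ ℚ.* ε             ≡⟨ ℚ.*-identityˡ ε ⟩
    ε                    ∎
    where open ≡-Reasoning

  sum-rearrange : ∀ a b c d → (a ℚ.+ b) ℚ.- (c ℚ.+ d) ≡ (a ℚ.- c) ℚ.+ (b ℚ.- d)
  sum-rearrange = solve 4 (λ a b c d → (a :+ b) :- (c :+ d) := (a :- c) :+ (b :- d)) refl
    where open +-*-Solver

  prod-rearrange : ∀ a b c d →
    (a ℚ.* b) ℚ.- (c ℚ.* d) ≡ a ℚ.* (b ℚ.- d) ℚ.+ d ℚ.* (a ℚ.- c)
  prod-rearrange =
    solve 4 (λ a b c d → (a :* b) :- (c :* d) := a :* (b :- d) :+ d :* (a :- c)) refl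
    where open +-*-Solver

  neg-rearrange : ∀ a b → (ℚ.- a) ℚ.- (ℚ.- b) ≡ ℚ.- (a ℚ.- b)
  neg-rearrange = solve 2 (λ a b → (:- a) :- (:- b) := :- (a :- b)) refl
    where open +-*-Solver

  cancel-rearrange : ∀ a b → a ≡ (a ℚ.- b) ℚ.+ b
  cancel-rearrange = solve 2 (λ a b → a := (a :- b) :+ b) refl
    where open +-*-Solver

  bound : ∀ x → ∃ λ B → ℚ.Positive B × ∃ λ N → ∀ i → N ℕ.≤ i → ℚ.∣ seq x i ∣ ℚ.≤ B
  bound x with cauchy x 1ℚ (ℚ.positive⁻¹ 1ℚ)
  ... | N , h = 1ℚ ℚ.+ b , ℚ.pos+nonNeg⇒pos 1ℚ b {{ℚ.nonNegative (ℚ.0≤∣p∣ (seq x N))}} , N ,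
      λ i N≤i → begin
        ℚ.∣ seq x i ∣                              ≡⟨ cong ℚ.∣_∣ (cancel-rearrange (seq x i) (seq x N)) ⟩
        ℚ.∣ (seq x i ℚ.- seq x N) ℚ.+ seq x N ∣    ≤⟨ ℚ.∣p+q∣≤∣p∣+∣q∣ (seq x i ℚ.- seq x N) (seq x N) ⟩
        ℚ.∣ seq x i ℚ.- seq x N ∣ ℚ.+ b            ≤⟨ ℚ.+-monoˡ-≤ b (ℚ.<⇒≤ (h i N N≤i ℕ.≤-refl)) ⟩
        1ℚ ℚ.+ b                                   ∎
    where
    open ℚ.≤-Reasoning
    b = ℚ.∣ seq x N ∣

  scaled : ∀ {ε} → 0ℚ ℚ.< ε → ∀ B → ℚ.Positive B →
           ∃ λ δ → 0ℚ ℚ.< δ × (∀ a c → ℚ.∣ a ∣ ℚ.≤ B → ℚ.∣ c ∣ ℚ.< δ → ℚ.∣ a ℚ.* c ∣ ℚ.< ε)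
  scaled {ε} 0<ε B B>0 = δ , 0<δ , λ a c a≤B c<δ → begin-strict
      ℚ.∣ a ℚ.* c ∣           ≡⟨ ℚ.∣p*q∣≡∣p∣*∣q∣ a c ⟩
      ℚ.∣ a ∣ ℚ.* ℚ.∣ c ∣     ≤⟨ ℚ.*-monoʳ-≤-nonNeg ℚ.∣ c ∣ {{ℚ.nonNegative (ℚ.0≤∣p∣ c)}} a≤B ⟩
      B ℚ.* ℚ.∣ c ∣           <⟨ ℚ.*-monoʳ-<-pos B c<δ ⟩
      B ℚ.* (1/ B ℚ.* ε)      ≡⟨ ℚ.*-assoc B (1/ B) ε ⟨
      (B ℚ.* 1/ B) ℚ.* ε      ≡⟨ cong (ℚ._* ε) (ℚ.*-inverseʳ B) ⟩
      1ℚ ℚ.* ε                ≡⟨ ℚ.*-identityˡ ε ⟩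
      ε                       ∎
    where
    open ℚ.≤-Reasoning
    instance
      _ = B>0
      _ = ℚ.pos⇒nonZero B
      _ = ℚ.1/pos⇒pos B
    δ = 1/ B ℚ.* ε
    0<δ : 0ℚ ℚ.< δ
    0<δ = subst (ℚ._< δ) (ℚ.*-zeroʳ (1/ B)) (ℚ.*-monoʳ-<-pos (1/ B) 0<ε)

fromℚ : ℚ → ℝ
fromℚ q = mkℝ (λ _ → q) λ ε 0<ε →
  0 , λ _ _ _ _ → subst (λ d → ℚ.∣ d ∣ ℚ.< ε) (sym (ℚ.+-inverseʳ q)) 0<ε

0ℝ 1ℝ : ℝ
0ℝ = fromℚ 0ℚ
1ℝ = fromℚ 1ℚ

infixl 6 _+ℝ_ _-ℝ_
infixl 7 _*ℝ_
infix  4 _<ℝ_ _⟶_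

_+ℝ_ : ℝ → ℝ → ℝ
x +ℝ y = mkℝ (λ i → seq x i ℚ.+ seq y i) λ ε 0<ε →
  let (M , hx) = cauchy x (½ ℚ.* ε) (half-pos 0<ε)
      (N , hy) = cauchy y (½ ℚ.* ε) (half-pos 0<ε)
      open ℚ.≤-Reasoning
  in M ℕ.⊔ N , λ i j Mi Mj → begin-strict
    ℚ.∣ (seq x i ℚ.+ seq y i) ℚ.- (seq x j ℚ.+ seq y j) ∣
      ≡⟨ cong ℚ.∣_∣ (sum-rearrange (seq x i) (seq y i) (seq x j) (seq y j)) ⟩
    ℚ.∣ (seq x i ℚ.- seq x j) ℚ.+ (seq y i ℚ.- seq y j) ∣
      ≤⟨ ℚ.∣p+q∣≤∣p∣+∣q∣ (seq x i ℚ.- seq x j) (seq y i ℚ.- seq y j) ⟩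
    ℚ.∣ seq x i ℚ.- seq x j ∣ ℚ.+ ℚ.∣ seq y i ℚ.- seq y j ∣
      <⟨ ℚ.+-mono-< (hx i j (ℕ.m⊔n≤o⇒m≤o M N Mi) (ℕ.m⊔n≤o⇒m≤o M N Mj))
                    (hy i j (ℕ.m⊔n≤o⇒n≤o M N Mi) (ℕ.m⊔n≤o⇒n≤o M N Mj)) ⟩
    ½ ℚ.* ε ℚ.+ ½ ℚ.* ε
      ≡⟨ halves ε ⟩
    ε ∎

-ℝ_ : ℝ → ℝ
-ℝ x = mkℝ (λ i → ℚ.- seq x i) λ ε 0<ε →
  let (N , h) = cauchy x ε 0<ε
  in N , λ i j Ni Nj → subst (ℚ._< ε)
       (trans (sym (ℚ.∣-p∣≡∣p∣ (seq x i ℚ.- seq x j)))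
              (cong ℚ.∣_∣ (sym (neg-rearrange (seq x i) (seq x j)))))
       (h i j Ni Nj)

_-ℝ_ : ℝ → ℝ → ℝ
x -ℝ y = x +ℝ (-ℝ y)

_*ℝ_ : ℝ → ℝ → ℝ
x *ℝ y = mkℝ (λ i → seq x i ℚ.* seq y i) λ ε 0<ε →
  let (A , A>0 , M₁ , x≤A)  = bound x
      (B , B>0 , M₂ , y≤B)  = bound y
      (δ , 0<δ , A·δ)       = scaled (half-pos 0<ε) A A>0
      (η , 0<η , B·η)       = scaled (half-pos 0<ε) B B>0
      (M₃ , hx)             = cauchy x η 0<η
      (M₄ , hy)             = cauchy y δ 0<δ
      L = M₁ ℕ.⊔ M₂
      R = M₃ ℕ.⊔ M₄
      open ℚ.≤-Reasoning
      ≥M₁ = λ {i} (p : L ℕ.⊔ R ℕ.≤ i) → ℕ.m⊔n≤o⇒m≤o M₁ M₂ (ℕ.m⊔n≤o⇒m≤o L R p)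
      ≥M₂ = λ {i} (p : L ℕ.⊔ R ℕ.≤ i) → ℕ.m⊔n≤o⇒n≤o M₁ M₂ (ℕ.m⊔n≤o⇒m≤o L R p)
      ≥M₃ = λ {i} (p : L ℕ.⊔ R ℕ.≤ i) → ℕ.m⊔n≤o⇒m≤o M₃ M₄ (ℕ.m⊔n≤o⇒n≤o L R p)
      ≥M₄ = λ {i} (p : L ℕ.⊔ R ℕ.≤ i) → ℕ.m⊔n≤o⇒n≤o M₃ M₄ (ℕ.m⊔n≤o⇒n≤o L R p)
  in L ℕ.⊔ R , λ i j Ni Nj → begin-strict
    ℚ.∣ (seq x i ℚ.* seq y i) ℚ.- (seq x j ℚ.* seq y j) ∣
      ≡⟨ cong ℚ.∣_∣ (prod-rearrange (seq x i) (seq y i) (seq x j) (seq y j)) ⟩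
    ℚ.∣ seq x i ℚ.* (seq y i ℚ.- seq y j) ℚ.+ seq y j ℚ.* (seq x i ℚ.- seq x j) ∣
      ≤⟨ ℚ.∣p+q∣≤∣p∣+∣q∣ (seq x i ℚ.* (seq y i ℚ.- seq y j)) (seq y j ℚ.* (seq x i ℚ.- seq x j)) ⟩
    ℚ.∣ seq x i ℚ.* (seq y i ℚ.- seq y j) ∣ ℚ.+ ℚ.∣ seq y j ℚ.* (seq x i ℚ.- seq x j) ∣
      <⟨ ℚ.+-mono-<
           (A·δ (seq x i) (seq y i ℚ.- seq y j) (x≤A i (≥M₁ Ni)) (hy i j (≥M₄ Ni) (≥M₄ Nj)))
           (B·η (seq y j) (seq x i ℚ.- seq x j) (y≤B j (≥M₂ Nj)) (hx i j (≥M₃ Ni) (≥M₃ Nj))) ⟩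
    ½ ℚ.* ε ℚ.+ ½ ℚ.* ε
      ≡⟨ halves ε ⟩
    ε ∎

∣_∣ℝ : ℝ → ℝ
∣ x ∣ℝ = mkℝ (λ i → ℚ.∣ seq x i ∣) λ ε 0<ε →
  let (N , h) = cauchy x ε 0<ε
  in N , λ i j Ni Nj → ℚ.≤-<-trans (reverse-triangle (seq x i) (seq x j)) (h i j Ni Nj)
  where
  open ℚ.≤-Reasoning

  one-sided : ∀ a b → ℚ.∣ a ∣ ℚ.- ℚ.∣ b ∣ ℚ.≤ ℚ.∣ a ℚ.- b ∣
  one-sided a b = begin
    ℚ.∣ a ∣ ℚ.- ℚ.∣ b ∣                          ≡⟨ cong (λ c → ℚ.∣ c ∣ ℚ.- ℚ.∣ b ∣) (cancel-rearrange a b) ⟩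
    ℚ.∣ (a ℚ.- b) ℚ.+ b ∣ ℚ.- ℚ.∣ b ∣            ≤⟨ ℚ.+-monoˡ-≤ (ℚ.- ℚ.∣ b ∣) (ℚ.∣p+q∣≤∣p∣+∣q∣ (a ℚ.- b) b) ⟩
    (ℚ.∣ a ℚ.- b ∣ ℚ.+ ℚ.∣ b ∣) ℚ.- ℚ.∣ b ∣      ≡⟨ ℚ.+-assoc ℚ.∣ a ℚ.- b ∣ ℚ.∣ b ∣ (ℚ.- ℚ.∣ b ∣) ⟩
    ℚ.∣ a ℚ.- b ∣ ℚ.+ (ℚ.∣ b ∣ ℚ.- ℚ.∣ b ∣)      ≡⟨ cong (ℚ.∣ a ℚ.- b ∣ ℚ.+_) (ℚ.+-inverseʳ ℚ.∣ b ∣) ⟩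
    ℚ.∣ a ℚ.- b ∣ ℚ.+ 0ℚ                         ≡⟨ ℚ.+-identityʳ _ ⟩
    ℚ.∣ a ℚ.- b ∣                                ∎

  swap : ∀ a b → b ℚ.- a ≡ ℚ.- (a ℚ.- b)
  swap = solve 2 (λ a b → b :- a := :- (a :- b)) refl
    where open +-*-Solver

  reverse-triangle : ∀ a b → ℚ.∣ ℚ.∣ a ∣ ℚ.- ℚ.∣ b ∣ ∣ ℚ.≤ ℚ.∣ a ℚ.- b ∣
  reverse-triangle a b with ℚ.∣p∣≡p∨∣p∣≡-p (ℚ.∣ a ∣ ℚ.- ℚ.∣ b ∣)
  ... | inj₁ eq = subst (ℚ._≤ ℚ.∣ a ℚ.- b ∣) (sym eq) (one-sided a b)
  ... | inj₂ eq = begin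
    ℚ.∣ ℚ.∣ a ∣ ℚ.- ℚ.∣ b ∣ ∣    ≡⟨ eq ⟩
    ℚ.- (ℚ.∣ a ∣ ℚ.- ℚ.∣ b ∣)    ≡⟨ swap ℚ.∣ a ∣ ℚ.∣ b ∣ ⟨
    ℚ.∣ b ∣ ℚ.- ℚ.∣ a ∣          ≤⟨ one-sided b a ⟩
    ℚ.∣ b ℚ.- a ∣                ≡⟨ cong ℚ.∣_∣ (swap a b) ⟩
    ℚ.∣ ℚ.- (a ℚ.- b) ∣          ≡⟨ ℚ.∣-p∣≡∣p∣ (a ℚ.- b) ⟩
    ℚ.∣ a ℚ.- b ∣                ∎

-- The sequences are eventually separated by a fixed positive rational.
_<ℝ_ : ℝ → ℝ → Set
x <ℝ y = ∃ λ δ → 0ℚ ℚ.< δ × ∃ λ N → ∀ i → N ℕ.≤ i → seq x i ℚ.+ δ ℚ.≤ seq y i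

_⟶_ : (ℕ → ℝ) → ℝ → Set
a ⟶ l = ∀ ε → 0ℝ <ℝ ε → ∃ λ N → ∀ n → N ℕ.≤ n → ∣ a n -ℝ l ∣ℝ <ℝ ε

∑ℝ : List ℝ → ℝ
∑ℝ = foldr _+ℝ_ 0ℝ

-- The lower triangle of an adjacency matrix: in r ∷ G, the subset r is the
-- set of neighbours of the vertex zero among the vertices of G, and vertex i
-- of G becomes suc i.  Each simple graph on Fin n is represented exactly once.
data Graph : ℕ → Set where
  []  : Graph 0
  _∷_ : Subset n → Graph n → Graph (suc n)

adj : Graph n → Fin n → Fin n → Bool
adj (r ∷ G) zero    zero    = false
adj (r ∷ G) zero    (suc j) = lookup r j
adj (r ∷ G) (suc i) zero    = lookup r i
adj (r ∷ G) (suc i) (suc j) = adj G i j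

Adj : Graph n → Fin n → Fin n → Set
Adj G x y = T (adj G x y)

adj? : (G : Graph n) → ∀ x y → Dec (Adj G x y)
adj? G x y = T? (adj G x y)

HasEdge : Graph n → Set
HasEdge G = ∃₂ λ x y → Adj G x y

N : Graph n → Fin n → Subset n
N G x = tabulate (adj G x)

d : Graph n → Fin n → ℕ
d G x = ∣ N G x ∣

e : Graph n → ℕ
e []      = 0
e (r ∷ G) = ∣ r ∣ ℕ.+ e G

addEdge : Fin n → Fin n → Graph n → Graph n
addEdge zero    zero    G       = G
addEdge zero    (suc j) (r ∷ G) = (r [ j ]≔ true) ∷ G
addEdge (suc i) zero    (r ∷ G) = (r [ i ]≔ true) ∷ G
addEdge (suc i) (suc j) (r ∷ G) = r ∷ addEdge i j G

subsets : ∀ n → List (Subset n)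
subsets zero    = [] ∷ []
subsets (suc n) = cartesianProductWith _∷_ (true ∷ false ∷ []) (subsets n)

graphs : ∀ n → List (Graph n)
graphs zero    = [] ∷ []
graphs (suc n) = cartesianProductWith _∷_ (subsets n) (graphs n)

infix 4 _⊑_

-- H ⊑ G: as H and G share the vertex set, H is a spanning subgraph of G.
_⊑_ : Graph n → Graph n → Set
H ⊑ G = ∀ x y → Adj H x y → Adj G x y

IsEmbedding : Graph k → Graph n → (Fin k → Fin n) → Set
IsEmbedding F G f = Injective _≡_ _≡_ f × (∀ x y → Adj F x y → Adj G (f x) (f y))

Contains : Graph n → Graph k → Set
Contains G F = ∃ (IsEmbedding F G)

Free : Graph k → Graph n → Set
Free F G = ¬ Contains G F

Saturated : Graph k → Graph n → Graph n → Set
Saturated F G H =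
  H ⊑ G × Free F H × (∀ x y → Adj G x y → ¬ Adj H x y → Contains (addEdge x y H) F)

private
  anyFun? : ∀ k {P : (Fin k → Fin n) → Set} → (∀ {f g} → f ≗ g → P f → P g) →
            Decidable P → Dec (∃ P)
  anyFun? zero    resp P? = map′ (_ ,_) (λ (f , pf) → resp (λ ()) pf) (P? λ ())
  anyFun? (suc k) resp P? = map′
    (λ (a , g , p) → a Fun.∷ g , p)
    (λ (f , p) → f zero , f ∘ suc , resp (λ { zero → refl ; (suc _) → refl }) p)
    (any? λ a → anyFun? k (λ f≗g → resp (λ { zero → refl ; (suc i) → f≗g i }))
                          (λ g → P? (a Fun.∷ g)))

isEmbedding? : (F : Graph k) (G : Graph n) → Decidable (IsEmbedding F G)
isEmbedding? F G f =
  map′ (λ h {x} {y} → h x y) (λ h x y → h {x} {y})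
       (all? λ x → all? λ y → f x ≟ᶠ f y →-dec x ≟ᶠ y)
  ×-dec all? λ x → all? λ y → adj? F x y →-dec adj? G (f x) (f y)

contains? : (G : Graph n) (F : Graph k) → Dec (Contains G F)
contains? G F = anyFun? _
  (λ f≗g (inj , hom) →
    (λ {x} {y} eq → inj (trans (f≗g x) (trans eq (sym (f≗g y))))) ,
    (λ x y xy → subst₂ (Adj G) (f≗g x) (f≗g y) (hom x y xy)))
  (isEmbedding? F G)

saturated? : (F : Graph k) (G : Graph n) → Decidable (Saturated F G)
saturated? F G H =
  (all? λ x → all? λ y → adj? H x y →-dec adj? G x y) ×-dec
  ¬? (contains? H F) ×-dec
  all? λ x → all? λ y → adj? G x y →-dec ¬? (adj? H x y) →-dec contains? (addEdge x y H) F

-- The first argument of min is an upper bound of all the values in the list,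
-- so it matters only if the list is empty; sat-attained and sat-least below
-- show that this is the minimum whenever F has an edge.
sat : Graph n → Graph k → ℕ
sat G F = min (e G) (map e (filter (saturated? F G) (graphs _)))

edgeWeight : Graph k → Fin k → Fin k → ℕ
edgeWeight F x y = (d F x ℕ.⊔ d F y) ℕ.+ ∣ N F x ∩ N F y ∣

-- Again k + k is an upper bound of all edge weights; see w-attained and w-least.
w : Graph k → ℕ
w {k} F = min (k ℕ.+ k)
  (map (uncurry (edgeWeight F))
       (filter (λ (x , y) → adj? F x y) (cartesianProduct (allFin k) (allFin k))))

-- ℙ(𝔾(n,p) = G), by independence: a factor p for each adjacent pair of G, 1 - p for each
-- non-adjacent pair.
weight : ℝ → Graph n → ℝ
weight p []      = 1ℝ
weight p (r ∷ G) = Vec.foldr′ (λ b t → (if b then p else 1ℝ -ℝ p) *ℝ t) (weight p G) r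

ℙ : ℝ → {A : Graph n → Set} → Decidable A → ℝ
ℙ p A? = ∑ℝ (map (weight p) (filter A? (graphs _)))

WithHighProbability : ℝ → {A : ∀ n → Graph n → Set} → (∀ n → Decidable (A n)) → Set
WithHighProbability p A? = (λ n → ℙ p (A? n)) ⟶ 1ℝ

fromℕ : ℕ → ℚ
fromℕ m = ℤ.+ m ℚ./ 1

private
  min-attained : ∀ {v u xs} → v ∈ xs → v ℕ.≤ u → min u xs ∈ xs
  min-attained {v} {u} {xs} v∈xs v≤u with argmin-sel id u xs
  ... | inj₂ m∈xs = m∈xs
  ... | inj₁ m≡u  = subst (_∈ xs) (ℕ.≤-antisym v≤m (All.lookup (min≤xs u xs) v∈xs)) v∈xs
    where v≤m = ℕ.≤-trans v≤u (ℕ.≤-reflexive (sym m≡u))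

w-least : (F : Graph k) → ∀ x y → Adj F x y → w F ℕ.≤ edgeWeight F x y
w-least F x y xy = All.lookup (min≤xs _ _)
  (∈-map⁺ _ (∈-filter⁺ (λ (x , y) → adj? F x y) (∈-cartesianProduct⁺ (∈-allFin x) (∈-allFin y)) xy))

w-attained : (F : Graph k) → HasEdge F → ∃₂ λ x y → Adj F x y × w F ≡ edgeWeight F x y
w-attained {k} F (x , y , xy) =
  let ((x′ , y′) , xy′∈ , eq) = ∈-map⁻ _ (min-attained
        (∈-map⁺ (uncurry (edgeWeight F))
          (∈-filter⁺ (λ (x , y) → adj? F x y)
            (∈-cartesianProduct⁺ (∈-allFin x) (∈-allFin y)) xy))
        (ℕ.+-mono-≤ (ℕ.⊔-lub (∣p∣≤n (N F x)) (∣p∣≤n (N F y)))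
                    (∣p∣≤n (N F x ∩ N F y))))
  in x′ , y′ , proj₂ (∈-filter⁻ (λ (x , y) → adj? F x y)
                                {xs = cartesianProduct (allFin k) (allFin k)} xy′∈) , eq

private
  ∈-subsets : (r : Subset n) → r ∈ subsets n
  ∈-subsets []          = here refl
  ∈-subsets (true ∷ r)  =
    ∈-cartesianProductWith⁺ _∷_ {xs = true ∷ false ∷ []} (here refl) (∈-subsets r)
  ∈-subsets (false ∷ r) =
    ∈-cartesianProductWith⁺ _∷_ {xs = true ∷ false ∷ []} (∈-++⁺ʳ (true ∷ []) (here refl)) (∈-subsets r)

∈-graphs : (G : Graph n) → G ∈ graphs n
∈-graphs []      = here refl
∈-graphs (r ∷ G) = ∈-cartesianProductWith⁺ _∷_ (∈-subsets r) (∈-graphs G)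

sat-least : (F : Graph k) (G H : Graph n) → Saturated F G H → sat G F ℕ.≤ e H
sat-least F G H s =
  All.lookup (min≤xs _ _) (∈-map⁺ e (∈-filter⁺ (saturated? F G) (∈-graphs H) s))

tail-⊑ : ∀ {r s} {H G : Graph n} → (r ∷ H) ⊑ (s ∷ G) → H ⊑ G
tail-⊑ sub x y = sub (suc x) (suc y)

∣∣-mono : (r s : Subset n) → (∀ i → T (lookup r i) → T (lookup s i)) → ∣ r ∣ ℕ.≤ ∣ s ∣
∣∣-mono []          []          h = ℕ.z≤n
∣∣-mono (true ∷ r)  (true ∷ s)  h = ℕ.s≤s (∣∣-mono r s (h ∘ suc))
∣∣-mono (true ∷ r)  (false ∷ s) h = ⊥-elim (h zero _)
∣∣-mono (false ∷ r) (true ∷ s)  h = ℕ.m≤n⇒m≤1+n (∣∣-mono r s (h ∘ suc))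
∣∣-mono (false ∷ r) (false ∷ s) h = ∣∣-mono r s (h ∘ suc)

e-mono : (H G : Graph n) → H ⊑ G → e H ℕ.≤ e G
e-mono []      []      sub = ℕ.z≤n
e-mono (r ∷ H) (s ∷ G) sub =
  ℕ.+-mono-≤ (∣∣-mono r s (sub zero ∘ suc)) (e-mono H G (tail-⊑ {r = r} {s} {H} {G} sub))

∣insert∣ : (r : Subset n) (i : Fin n) → ¬ T (lookup r i) → ∣ r [ i ]≔ true ∣ ≡ suc ∣ r ∣
∣insert∣ (true ∷ r)  zero    i∉r = ⊥-elim (i∉r _)
∣insert∣ (false ∷ r) zero    i∉r = refl
∣insert∣ (true ∷ r)  (suc i) i∉r = cong suc (∣insert∣ r i i∉r)
∣insert∣ (false ∷ r) (suc i) i∉r = ∣insert∣ r i i∉r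

e-addEdge : ∀ x y (G H : Graph n) → Adj G x y → ¬ Adj H x y → e (addEdge x y H) ≡ suc (e H)
e-addEdge zero    zero    (s ∷ G) (r ∷ H) () _
e-addEdge zero    (suc j) (s ∷ G) (r ∷ H) _ xy∉H = cong (ℕ._+ e H) (∣insert∣ r j xy∉H)
e-addEdge (suc i) zero    (s ∷ G) (r ∷ H) _ xy∉H = cong (ℕ._+ e H) (∣insert∣ r i xy∉H)
e-addEdge (suc i) (suc j) (s ∷ G) (r ∷ H) xy∈G xy∉H =
  trans (cong (∣ r ∣ ℕ.+_) (e-addEdge i j G H xy∈G xy∉H)) (ℕ.+-suc ∣ r ∣ (e H))

insert-⊆ : (r s : Subset n) (i : Fin n) → (∀ j → T (lookup r j) → T (lookup s j)) →
           T (lookup s i) → ∀ j → T (lookup (r [ i ]≔ true) j) → T (lookup s j)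
insert-⊆ (_ ∷ r) (_ ∷ s) zero    sub i∈s zero    _ = i∈s
insert-⊆ (_ ∷ r) (_ ∷ s) zero    sub i∈s (suc j) h = sub (suc j) h
insert-⊆ (_ ∷ r) (_ ∷ s) (suc i) sub i∈s zero    h = sub zero h
insert-⊆ (_ ∷ r) (_ ∷ s) (suc i) sub i∈s (suc j) h = insert-⊆ r s i (sub ∘ suc) i∈s j h

insert-⊑ : ∀ {r s} {H G : Graph n} i → (r ∷ H) ⊑ (s ∷ G) → T (lookup s i) →
           ((r [ i ]≔ true) ∷ H) ⊑ (s ∷ G)
insert-⊑ {r = r} {s} i sub i∈s zero    (suc y) = insert-⊆ r s i (sub zero ∘ suc) i∈s y
insert-⊑ {r = r} {s} i sub i∈s (suc x) zero    = insert-⊆ r s i (sub zero ∘ suc) i∈s x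
insert-⊑ i sub i∈s (suc x) (suc y) = sub (suc x) (suc y)

addEdge-⊑ : ∀ x y (G H : Graph n) → H ⊑ G → Adj G x y → addEdge x y H ⊑ G
addEdge-⊑ zero    (suc j) (s ∷ G) (r ∷ H) sub xy = insert-⊑ {r = r} {s} {H} {G} j sub xy
addEdge-⊑ (suc i) zero    (s ∷ G) (r ∷ H) sub xy = insert-⊑ {r = r} {s} {H} {G} i sub xy
addEdge-⊑ (suc i) (suc j) (s ∷ G) (r ∷ H) sub xy zero    (suc y) = sub zero (suc y)
addEdge-⊑ (suc i) (suc j) (s ∷ G) (r ∷ H) sub xy (suc x) zero    = sub (suc x) zero
addEdge-⊑ (suc i) (suc j) (s ∷ G) (r ∷ H) sub xy (suc x) (suc y) =
  addEdge-⊑ i j G H (tail-⊑ {r = r} {s} {H} {G} sub) xy x y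

edgeless : ∀ n → Graph n
edgeless zero    = []
edgeless (suc n) = Subset.⊥ ∷ edgeless n

∉⊥ : (i : Fin n) → ¬ T (lookup Subset.⊥ i)
∉⊥ (suc i) = ∉⊥ i

¬adj-edgeless : ∀ (x y : Fin n) → ¬ Adj (edgeless n) x y
¬adj-edgeless zero    (suc y) = ∉⊥ y
¬adj-edgeless (suc x) zero    = ∉⊥ x
¬adj-edgeless (suc x) (suc y) = ¬adj-edgeless x y

-- Add edges greedily for as long as no copy of F is created.
saturate : ∀ fuel (F : Graph k) (G H : Graph n) → e G ℕ.≤ fuel ℕ.+ e H →
           H ⊑ G → Free F H → ∃ (Saturated F G)
saturate fuel F G H enough sub free
  with any? (λ x → any? λ y →
         adj? G x y ×-dec ¬? (adj? H x y) ×-dec ¬? (contains? (addEdge x y H) F))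
... | no none = H , sub , free , λ x y xy∈G xy∉H → decide x y xy∈G xy∉H
  where
  decide : ∀ x y → Adj G x y → ¬ Adj H x y → Contains (addEdge x y H) F
  decide x y xy∈G xy∉H with contains? (addEdge x y H) F
  ... | yes c = c
  ... | no ¬c = ⊥-elim (none (x , y , xy∈G , xy∉H , ¬c))
saturate zero F G H enough sub free | yes (x , y , xy∈G , xy∉H , _) =
  ⊥-elim (ℕ.1+n≰n (ℕ.≤-trans (subst (ℕ._≤ e G) (e-addEdge x y G H xy∈G xy∉H)
                               (e-mono (addEdge x y H) G (addEdge-⊑ x y G H sub xy∈G))) enough))
saturate (suc fuel) F G H enough sub free | yes (x , y , xy∈G , xy∉H , free′) =
  saturate fuel F G (addEdge x y H)
    (subst (e G ℕ.≤_)
      (trans (sym (ℕ.+-suc fuel (e H))) (cong (fuel ℕ.+_) (sym (e-addEdge x y G H xy∈G xy∉H))))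
      enough)
    (addEdge-⊑ x y G H sub xy∈G) free′

saturated-exists : (F : Graph k) → HasEdge F → (G : Graph n) → ∃ (Saturated F G)
saturated-exists F (a , b , ab) G = saturate (e G) F G (edgeless _) (ℕ.m≤m+n (e G) _)
  (λ x y h → ⊥-elim (¬adj-edgeless x y h))
  (λ (f , _ , hom) → ¬adj-edgeless (f a) (f b) (hom a b ab))

sat-attained : (F : Graph k) → HasEdge F → (G : Graph n) →
               ∃ λ H → Saturated F G H × sat G F ≡ e H
sat-attained F edge G =
  let (H , s)         = saturated-exists F edge G
      (H′ , H′∈ , eq) = ∈-map⁻ e (min-attained
        (∈-map⁺ e (∈-filter⁺ (saturated? F G) (∈-graphs H) s))
        (e-mono H G (proj₁ s)))
  in H′ , proj₂ (∈-filter⁻ (saturated? F G) {xs = graphs _} H′∈) , eq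

{-# OPTIONS --safe #-}
module Submission where

-- Let H be a smallest F-saturated subgraph of G and W = w(F) - 1.  Adding an edge xy of G ∖ H
-- creates a copy of F through xy, hence max(d x, d y) + |N x ∩ N y| ≥ W, degrees and
-- neighbourhoods being those of H.  Let X consist of m vertices of least degree, let B consist
-- of X and of the neighbours of the vertices of X of degree at most W, and let Z be the set of
-- vertices outside B that G does not join to X.  Then |B| ≤ m + W m, and every y outside B ∪ Z
-- satisfies d y + |N y ∩ B| ≥ W.  Charging the edges from y into B to their ends in B, the sum
-- over y gives W (n - |B| - |Z|) ≤ 2 e(H).  If |Z| ≥ m, then G has none of the m² edges
-- between two disjoint sets of m vertices; for m = c ⌊log₂ n⌋ and a large constant c this has
-- probability at most ((1 + n)² (1 - p)^m)^m ≤ (1/2)^⌊log₂ n⌋ by the union bound.  The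
-- probability is estimated at the rational approximations seq p i, uniformly in i.

open import Defs
open import Algebra.Bundles using (module CommutativeRing)
open import Data.Bool.Base using (Bool; true; false; T; if_then_else_; not; _∧_)
open import Data.Bool.Properties using (T-≡)
open import Data.Empty using (⊥-elim)
open import Data.Fin.Base using (Fin; zero; suc)
open import Data.Fin.Properties using (any?; all?; suc-injective; 0≢1+n)
open import Data.Fin.Subset
  using (Subset; inside; outside; _∈_; _∉_; _⊆_; _∩_; _∪_; ⊥; ⊤; ⁅_⁆; ∣_∣)
  renaming (_-_ to _∖_)
open import Data.Fin.Subset.Properties
  using (_∈?_; x∈p∧x≢y⇒x∈p-y; x∈p∩q⁺; x∈p∩q⁻; p⊆p∪q; q⊆p∪q; x∈⁅x⁆; ∣⁅x⁆∣≡1; x∈p⇒∣p-x∣<∣p∣;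
         ∣⊤∣≡n; ∣⊥∣≡0; p⊆q⇒∣p∣≤∣q∣; s⊆s)
  renaming (∉⊥ to ∉⊥-Subset)
open import Data.Integer.Base as ℤ using ()
import Data.Integer.Properties as ℤ
open import Data.List.Base
  using (List; []; _∷_; _++_; map; foldr; filter; allFin; length; cartesianProductWith)
open import Data.List.Extrema.Nat using (argmin; argmin-all; f[argmin]≤f[xs])
open import Data.List.Membership.Propositional using () renaming (_∈_ to _∈ˡ_)
open import Data.List.Membership.Propositional.Properties
  using (∈-filter⁺; ∈-filter⁻; ∈-allFin; ∈-map⁺; ∈-++⁺ˡ; ∈-++⁺ʳ; ∈-cartesianProductWith⁺)
open import Data.List.Properties using (map-∘; map-cong; length-++; length-map; length-filter)
import Data.List.Relation.Unary.All as All
open import Data.List.Relation.Unary.All.Properties using (all-filter)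
open import Data.List.Relation.Unary.Any using () renaming (here to hereˡ; there to thereˡ)
open import Data.Nat.Base as ℕ using (ℕ; zero; suc)
open import Data.Nat.Logarithm using (⌊log₂_⌋; ⌊log₂⌋-mono-≤; ⌊log₂[2^n]⌋≡n)
import Data.Nat.Properties as ℕ
import Data.Nat.Solver as ℕ-Solver
open import Data.Product.Base using (∃; ∃₂; _×_; _,_; proj₁; proj₂)
open import Data.Rational.Base as ℚ using (ℚ; 0ℚ; 1ℚ; ½; _+_; _-_; _*_; -_; _≤_; _<_)
open import Data.Rational.Properties as ℚ using (_≤?_)
open import Data.Rational.Solver using (module +-*-Solver)
open import Data.Rational.Unnormalised.Base as ℚᵘ using (mkℚᵘ)
import Data.Rational.Unnormalised.Properties as ℚᵘ
import Data.Sum.Base as Sum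
open Sum using (_⊎_; inj₁; inj₂; [_,_]′)
open import Data.Vec.Base as Vec using ([]; _∷_; lookup; tabulate; _[_]≔_; here; there)
open import Data.Vec.Properties
  using ([]=⇒lookup; lookup⇒[]=; lookup∘tabulate; tabulate∘lookup)
open import Function.Base using (_∘_)
open import Function.Bundles using (Equivalence)
open import Function.Definitions using (Injective)
open import Relation.Binary.PropositionalEquality hiding (J)
open import Relation.Nullary using (¬_; Dec; yes; no; does)
open import Relation.Nullary.Decidable
  using (_×-dec_; _⊎-dec_; ¬?; decidable-stable; dec-true; toWitness; isYes≗does)
open import Relation.Unary using (Decidable)

open import Algebra.Properties.CommutativeMonoid.Sum ℕ.+-0-commutativeMonoid
  using (sum; sum-cong-≗; ∑-distrib-+; ∑-comm)
open import Algebra.Properties.CommutativeSemiring.Exp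
  (CommutativeRing.commutativeSemiring ℚ.+-*-commutativeRing)
  using (_^_; ^-homo-*; ^-assocʳ; ^-distrib-*)

private
  variable
    k n : ℕ
    I I′ I″ : Set

-- The weight of an edge that creates a copy of F

T⇒≡ : ∀ {b} → T b → b ≡ true
T⇒≡ = Equivalence.to T-≡

≡⇒T : ∀ {b} → b ≡ true → T b
≡⇒T = Equivalence.from T-≡

Adj⇒∈N : (G : Graph n) {x y : Fin n} → Adj G x y → y ∈ N G x
Adj⇒∈N G {x} {y} xy = lookup⇒[]= y (N G x) (trans (lookup∘tabulate (adj G x) y) (T⇒≡ xy))

∈N⇒Adj : (G : Graph n) {x y : Fin n} → y ∈ N G x → Adj G x y
∈N⇒Adj G {x} {y} y∈ = ≡⇒T (trans (sym (lookup∘tabulate (adj G x) y)) ([]=⇒lookup y∈))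

adj-sym : (G : Graph n) → ∀ x y → adj G x y ≡ adj G y x
adj-sym (r ∷ G) zero    zero    = refl
adj-sym (r ∷ G) zero    (suc y) = refl
adj-sym (r ∷ G) (suc x) zero    = refl
adj-sym (r ∷ G) (suc x) (suc y) = adj-sym G x y

Adj-sym : (G : Graph n) → ∀ x y → Adj G x y → Adj G y x
Adj-sym G x y = subst T (adj-sym G x y)

Adj-irrefl : (G : Graph n) → ∀ x → ¬ Adj G x x
Adj-irrefl (r ∷ G) (suc x) = Adj-irrefl G x

lookup-insert : (r : Subset n) (i j : Fin n) → T (lookup (r [ i ]≔ true) j) → T (lookup r j) ⊎ j ≡ i
lookup-insert (_ ∷ r) zero    zero    _ = inj₂ refl
lookup-insert (_ ∷ r) zero    (suc j) h = inj₁ h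
lookup-insert (_ ∷ r) (suc i) zero    h = inj₁ h
lookup-insert (_ ∷ r) (suc i) (suc j) h with lookup-insert r i j h
... | inj₁ h′ = inj₁ h′
... | inj₂ eq = inj₂ (cong suc eq)

addEdge-Adj⁻ : ∀ x y (H : Graph n) a b → Adj (addEdge x y H) a b →
               Adj H a b ⊎ (a ≡ x × b ≡ y) ⊎ (a ≡ y × b ≡ x)
addEdge-Adj⁻ zero    zero    H       a       b       h = inj₁ h
addEdge-Adj⁻ zero    (suc j) (r ∷ H) zero    (suc b) h with lookup-insert r j b h
... | inj₁ h′ = inj₁ h′
... | inj₂ eq = inj₂ (inj₁ (refl , cong suc eq))
addEdge-Adj⁻ zero    (suc j) (r ∷ H) (suc a) zero    h with lookup-insert r j a h
... | inj₁ h′ = inj₁ h′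
... | inj₂ eq = inj₂ (inj₂ (cong suc eq , refl))
addEdge-Adj⁻ zero    (suc j) (r ∷ H) (suc a) (suc b) h = inj₁ h
addEdge-Adj⁻ (suc i) zero    (r ∷ H) zero    (suc b) h with lookup-insert r i b h
... | inj₁ h′ = inj₁ h′
... | inj₂ eq = inj₂ (inj₂ (refl , cong suc eq))
addEdge-Adj⁻ (suc i) zero    (r ∷ H) (suc a) zero    h with lookup-insert r i a h
... | inj₁ h′ = inj₁ h′
... | inj₂ eq = inj₂ (inj₁ (cong suc eq , refl))
addEdge-Adj⁻ (suc i) zero    (r ∷ H) (suc a) (suc b) h = inj₁ h
addEdge-Adj⁻ (suc i) (suc j) (r ∷ H) zero    (suc b) h = inj₁ h
addEdge-Adj⁻ (suc i) (suc j) (r ∷ H) (suc a) zero    h = inj₁ h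
addEdge-Adj⁻ (suc i) (suc j) (r ∷ H) (suc a) (suc b) h with addEdge-Adj⁻ i j H a b h
... | inj₁ h′                = inj₁ h′
... | inj₂ (inj₁ (p , q)) = inj₂ (inj₁ (cong suc p , cong suc q))
... | inj₂ (inj₂ (p , q)) = inj₂ (inj₂ (cong suc p , cong suc q))

-- Induction on `S`. When `zero` is in `S`, its image is deleted from `U`; by injectivity the images
-- of the other elements survive the deletion.
∣∣-injection : (S : Subset k) (U : Subset n) (f : Fin k → Fin n) → Injective _≡_ _≡_ f →
               (∀ {i} → i ∈ S → f i ∈ U) → ∣ S ∣ ℕ.≤ ∣ U ∣
∣∣-injection []            U f inj f∈ = ℕ.z≤n
∣∣-injection (outside ∷ S) U f inj f∈ = ∣∣-injection S U (f ∘ suc) (suc-injective ∘ inj) (f∈ ∘ there)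
∣∣-injection (inside ∷ S)  U f inj f∈ = ℕ.≤-trans
  (ℕ.s≤s (∣∣-injection S (U ∖ f zero) (f ∘ suc) (suc-injective ∘ inj)
    λ i∈S → x∈p∧x≢y⇒x∈p-y (f∈ (there i∈S)) (0≢1+n ∘ sym ∘ inj)))
  (x∈p⇒∣p-x∣<∣p∣ (f∈ here))

∣p∪q∣≤∣p∣+∣q∣ : (p q : Subset n) → ∣ p ∪ q ∣ ℕ.≤ ∣ p ∣ ℕ.+ ∣ q ∣
∣p∪q∣≤∣p∣+∣q∣ []          []          = ℕ.z≤n
∣p∪q∣≤∣p∣+∣q∣ (true ∷ p)  (true ∷ q)  =
  ℕ.s≤s (ℕ.≤-trans (∣p∪q∣≤∣p∣+∣q∣ p q) (ℕ.+-monoʳ-≤ ∣ p ∣ (ℕ.n≤1+n ∣ q ∣)))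
∣p∪q∣≤∣p∣+∣q∣ (true ∷ p)  (false ∷ q) = ℕ.s≤s (∣p∪q∣≤∣p∣+∣q∣ p q)
∣p∪q∣≤∣p∣+∣q∣ (false ∷ p) (true ∷ q)  =
  subst (suc ∣ p ∪ q ∣ ℕ.≤_) (sym (ℕ.+-suc ∣ p ∣ ∣ q ∣)) (ℕ.s≤s (∣p∪q∣≤∣p∣+∣q∣ p q))
∣p∪q∣≤∣p∣+∣q∣ (false ∷ p) (false ∷ q) = ∣p∪q∣≤∣p∣+∣q∣ p q

module NewEdge (F : Graph k) (H : Graph n) (f : Fin k → Fin n) (inj : Injective _≡_ _≡_ f) where

  -- The exceptional pair is compared through its images, as `addEdge-Adj⁻` delivers it; injectivity
  -- of `f` turns these equations into equations in `F` when needed.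
  HomExcept : Fin k → Fin k → Set
  HomExcept u v = ∀ s t → Adj F s t →
    Adj H (f s) (f t) ⊎ (f s ≡ f u × f t ≡ f v) ⊎ (f s ≡ f v × f t ≡ f u)

  HomExcept-sym : ∀ {u v} → HomExcept u v → HomExcept v u
  HomExcept-sym hom s t st = Sum.map₂ Sum.swap (hom s t st)

  -- Only the edge uv at `u` may be mapped to a non-edge of `H`, and its other end goes to `f v`;
  -- this one extra vertex accounts for the `suc`.
  degree-≤ : ∀ {u v} → Adj F u v → HomExcept u v → d F u ℕ.≤ suc (d H (f u))
  degree-≤ {u} {v} uv hom = begin
    d F u                             ≤⟨ ∣∣-injection (N F u) (N H (f u) ∪ ⁅ f v ⁆) f inj image ⟩
    ∣ N H (f u) ∪ ⁅ f v ⁆ ∣           ≤⟨ ∣p∪q∣≤∣p∣+∣q∣ (N H (f u)) ⁅ f v ⁆ ⟩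
    d H (f u) ℕ.+ ∣ ⁅ f v ⁆ ∣         ≡⟨ cong (d H (f u) ℕ.+_) (∣⁅x⁆∣≡1 (f v)) ⟩
    d H (f u) ℕ.+ 1                   ≡⟨ ℕ.+-comm (d H (f u)) 1 ⟩
    suc (d H (f u))                   ∎
    where
    open ℕ.≤-Reasoning
    image : ∀ {t} → t ∈ N F u → f t ∈ N H (f u) ∪ ⁅ f v ⁆
    image {t} t∈ with hom u t (∈N⇒Adj F t∈)
    ... | inj₁ h                  = p⊆p∪q ⁅ f v ⁆ (Adj⇒∈N H h)
    ... | inj₂ (inj₁ (_ , ft≡fv)) = q⊆p∪q (N H (f u)) ⁅ f v ⁆ (subst (_∈ ⁅ f v ⁆) (sym ft≡fv) (x∈⁅x⁆ (f v)))
    ... | inj₂ (inj₂ (fu≡fv , _)) = ⊥-elim (Adj-irrefl F v (subst (λ z → Adj F z v) (inj fu≡fv) uv))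

  -- The codegree grows by nothing: a common neighbour t of `u` and `v` differs from both, since
  -- there are no loops, so neither ut nor vt is the exceptional edge and `f t` is already a common
  -- neighbour in `H`.
  edgeWeight-≤ : ∀ {u v} → Adj F u v → HomExcept u v →
                 edgeWeight F u v ℕ.≤ suc (d H (f u) ℕ.⊔ d H (f v)) ℕ.+ ∣ N H (f u) ∩ N H (f v) ∣
  edgeWeight-≤ {u} {v} uv hom = ℕ.+-mono-≤
    (ℕ.⊔-mono-≤ (degree-≤ uv hom) (degree-≤ (Adj-sym F u v uv) (HomExcept-sym hom)))
    (∣∣-injection (N F u ∩ N F v) (N H (f u) ∩ N H (f v)) f inj image)
    where
    image : ∀ {t} → t ∈ N F u ∩ N F v → f t ∈ N H (f u) ∩ N H (f v)
    image {t} t∈ with x∈p∩q⁻ (N F u) (N F v) t∈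
    ... | t∈u , t∈v with hom u t (∈N⇒Adj F t∈u) | hom v t (∈N⇒Adj F t∈v)
    ...   | inj₁ ut                     | inj₁ vt                     = x∈p∩q⁺ (Adj⇒∈N H ut , Adj⇒∈N H vt)
    ...   | inj₂ (inj₁ (_ , ft≡fv))     | _                           =
      ⊥-elim (Adj-irrefl F v (subst (Adj F v) (inj ft≡fv) (∈N⇒Adj F t∈v)))
    ...   | inj₂ (inj₂ (fu≡fv , ft≡fu)) | _                           =
      ⊥-elim (Adj-irrefl F u (subst (Adj F u) (inj ft≡fu) (∈N⇒Adj F t∈u)))
    ...   | inj₁ _                      | inj₂ (inj₁ (fv≡fu , ft≡fv)) =
      ⊥-elim (Adj-irrefl F v (subst (Adj F v) (inj ft≡fv) (∈N⇒Adj F t∈v)))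
    ...   | inj₁ _                      | inj₂ (inj₂ (_ , ft≡fu))     =
      ⊥-elim (Adj-irrefl F u (subst (Adj F u) (inj ft≡fu) (∈N⇒Adj F t∈u)))

-- A copy of F that appears together with xy has xy as the image of some edge uv of F.
w≤-of-new-copy : (F : Graph k) (H : Graph n) → Free F H → ∀ x y → Contains (addEdge x y H) F →
                 w F ℕ.≤ suc (d H x ℕ.⊔ d H y) ℕ.+ ∣ N H x ∩ N H y ∣
w≤-of-new-copy F H free x y (f , inj , hom)
  with any? (λ u → any? λ v → adj? F u v ×-dec ¬? (adj? H (f u) (f v)))
... | no none = ⊥-elim (free (f , inj , λ u v uv → decidable-stable (adj? H (f u) (f v))
                                  λ ¬uv → none (u , v , uv , ¬uv)))
... | yes (u , v , uv , ¬uv) with addEdge-Adj⁻ x y H (f u) (f v) (hom u v uv)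
...   | inj₁ h = ⊥-elim (¬uv h)
...   | inj₂ (inj₁ (refl , refl)) = ℕ.≤-trans (w-least F u v uv)
  (NewEdge.edgeWeight-≤ F H f inj uv λ s t st → addEdge-Adj⁻ x y H (f s) (f t) (hom s t st))
...   | inj₂ (inj₂ (refl , refl)) = ℕ.≤-trans (w-least F v u (Adj-sym F u v uv))
  (NewEdge.edgeWeight-≤ F H f inj (Adj-sym F u v uv)
    λ s t st → addEdge-Adj⁻ x y H (f s) (f t) (hom s t st))

-- Counting degrees

∑-mono : {f g : Fin n → ℕ} → (∀ i → f i ℕ.≤ g i) → sum f ℕ.≤ sum g
∑-mono {zero}  f≤g = ℕ.z≤n
∑-mono {suc n} f≤g = ℕ.+-mono-≤ (f≤g zero) (∑-mono (f≤g ∘ suc))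

∑-const : ∀ n c → sum {n} (λ _ → c) ≡ c ℕ.* n
∑-const zero    c = sym (ℕ.*-zeroʳ c)
∑-const (suc n) c = trans (cong (c ℕ.+_) (∑-const n c)) (sym (ℕ.*-suc c n))

∑-*ˡ : ∀ c (f : Fin n → ℕ) → sum (λ i → c ℕ.* f i) ≡ c ℕ.* sum f
∑-*ˡ {zero}  c f = sym (ℕ.*-zeroʳ c)
∑-*ˡ {suc n} c f = trans (cong (c ℕ.* f zero ℕ.+_) (∑-*ˡ c (f ∘ suc)))
                         (sym (ℕ.*-distribˡ-+ c (f zero) (sum (f ∘ suc))))

𝟙 : Bool → ℕ
𝟙 b = if b then 1 else 0

∣tabulate∣ : (f : Fin n → Bool) → ∣ tabulate f ∣ ≡ sum (𝟙 ∘ f)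
∣tabulate∣ {zero}  f = refl
∣tabulate∣ {suc n} f with f zero
... | true  = cong suc (∣tabulate∣ (f ∘ suc))
... | false = ∣tabulate∣ (f ∘ suc)

∣∣≡∑ : (S : Subset n) → ∣ S ∣ ≡ sum (𝟙 ∘ lookup S)
∣∣≡∑ S = trans (cong ∣_∣ (sym (tabulate∘lookup S))) (∣tabulate∣ (lookup S))

d≡∑ : (G : Graph n) → ∀ x → d G x ≡ sum (λ y → 𝟙 (adj G x y))
d≡∑ G x = ∣tabulate∣ (adj G x)

-- An edge in the first row is counted once in the degree of `zero` and once in that of its other
-- end, which gives `∣ r ∣` twice; the remaining edges are handled by induction.
handshake : (G : Graph n) → sum (d G) ≡ 2 ℕ.* e G
handshake []      = refl
handshake (r ∷ G) = begin
  d (r ∷ G) zero ℕ.+ sum (λ i → d (r ∷ G) (suc i))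
    ≡⟨ cong₂ ℕ._+_ (trans (d≡∑ (r ∷ G) zero) (sym (∣∣≡∑ r)))
         (trans (sum-cong-≗ λ i → trans (d≡∑ (r ∷ G) (suc i)) (cong (𝟙 (lookup r i) ℕ.+_) (sym (d≡∑ G i))))
                (∑-distrib-+ (𝟙 ∘ lookup r) (d G))) ⟩
  ∣ r ∣ ℕ.+ (sum (𝟙 ∘ lookup r) ℕ.+ sum (d G))
    ≡⟨ cong₂ (λ a b → ∣ r ∣ ℕ.+ (a ℕ.+ b)) (sym (∣∣≡∑ r)) (handshake G) ⟩
  ∣ r ∣ ℕ.+ (∣ r ∣ ℕ.+ 2 ℕ.* e G)
    ≡⟨ solve 2 (λ a b → a :+ (a :+ con 2 :* b) := con 2 :* (a :+ b)) refl ∣ r ∣ (e G) ⟩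
  2 ℕ.* (∣ r ∣ ℕ.+ e G) ∎
  where
  open ≡-Reasoning
  open ℕ-Solver.+-*-Solver

module Counting
  (G H : Graph n) (W : ℕ)
  (heavy : ∀ x y → Adj G x y → ¬ Adj H x y → W ℕ.≤ (d H x ℕ.⊔ d H y) ℕ.+ ∣ N H x ∩ N H y ∣)
  (X : Subset n) (X-least : ∀ {x y} → x ∈ X → y ∉ X → d H x ℕ.≤ d H y)
  where

  -- The restriction to degree at most `W` keeps `B` small. The conditions on x alone are grouped
  -- first, so that the bound `few` can decide them outside the sum over y.
  LowNeighbour : Fin n → Fin n → Set
  LowNeighbour y x = (x ∈ X × d H x ℕ.≤ W) × Adj H x y

  lowNeighbour? : ∀ y x → Dec (LowNeighbour y x)
  lowNeighbour? y x = (x ∈? X ×-dec d H x ℕ.≤? W) ×-dec adj? H x y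

  B : Fin n → Set
  B y = y ∈ X ⊎ ∃ (LowNeighbour y)

  B? : Decidable B
  B? y = (y ∈? X) ⊎-dec any? (lowNeighbour? y)

  Z : Fin n → Set
  Z y = ¬ B y × (∀ x → ¬ (x ∈ X × Adj G x y))

  Z? : Decidable Z
  Z? y = ¬? (B? y) ×-dec all? λ x → ¬? ((x ∈? X) ×-dec adj? G x y)

  ∣Z∣ : ℕ
  ∣Z∣ = ∣ tabulate (does ∘ Z?) ∣

  ∣B∣ : ℕ
  ∣B∣ = sum (λ y → 𝟙 (does (B? y)))

  intoB : Fin n → ℕ
  intoB y = sum (λ z → 𝟙 (does (B? z)) ℕ.* 𝟙 (adj H y z))

  -- As `x` is a vertex of `X` of low degree, all its neighbours lie in `B`; a common neighbour of
  -- `x` and `y` is therefore the end of an edge from `y` into `B`.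
  codegree≤intoB : ∀ {x y} → x ∈ X → d H x ℕ.≤ W → ∣ N H x ∩ N H y ∣ ℕ.≤ intoB y
  codegree≤intoB {x} {y} x∈X low = subst (ℕ._≤ intoB y) (sym (∣∣≡∑ (N H x ∩ N H y))) (∑-mono bound)
    where
    bound : ∀ z → 𝟙 (lookup (N H x ∩ N H y) z) ℕ.≤ 𝟙 (does (B? z)) ℕ.* 𝟙 (adj H y z)
    bound z with lookup (N H x ∩ N H y) z in eq
    ... | false = ℕ.z≤n
    ... | true with x∈p∩q⁻ (N H x) (N H y) (lookup⇒[]= z _ eq)
    ...   | z∈x , z∈y
            rewrite dec-true (B? z) (inj₂ (x , (x∈X , low) , ∈N⇒Adj H z∈x)) | T⇒≡ (∈N⇒Adj H z∈y) = ℕ.≤-refl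

  -- Let x ∈ X be a G-neighbour of y.  If d x > W, then d y ≥ d x suffices; otherwise xy is not
  -- an edge of H, because y ∉ B.
  W≤ : ∀ y → ¬ B y → ¬ Z y → W ℕ.≤ d H y ℕ.+ intoB y
  W≤ y ¬By ¬Zy with any? (λ x → (x ∈? X) ×-dec adj? G x y)
  ... | no none = ⊥-elim (¬Zy (¬By , λ x h → none (x , h)))
  ... | yes (x , x∈X , xy) with d H x ℕ.≤? W
  ...   | no high = begin
    W                       ≤⟨ ℕ.<⇒≤ (ℕ.≰⇒> high) ⟩
    d H x                   ≤⟨ X-least x∈X (¬By ∘ inj₁) ⟩
    d H y                   ≤⟨ ℕ.m≤m+n (d H y) (intoB y) ⟩
    d H y ℕ.+ intoB y       ∎
    where open ℕ.≤-Reasoning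
  ...   | yes low = begin
    W
      ≤⟨ heavy x y xy (λ h → ¬By (inj₂ (x , (x∈X , low) , h))) ⟩
    (d H x ℕ.⊔ d H y) ℕ.+ ∣ N H x ∩ N H y ∣
      ≡⟨ cong (ℕ._+ ∣ N H x ∩ N H y ∣) (ℕ.m≤n⇒m⊔n≡n (X-least x∈X (¬By ∘ inj₁))) ⟩
    d H y ℕ.+ ∣ N H x ∩ N H y ∣
      ≤⟨ ℕ.+-monoʳ-≤ (d H y) (codegree≤intoB x∈X low) ⟩
    d H y ℕ.+ intoB y ∎
    where open ℕ.≤-Reasoning

  -- The degrees of vertices in `B` are left out here because the sum of `intoB` supplies exactly
  -- these.
  outB : Fin n → ℕ
  outB y = 𝟙 (not (does (B? y))) ℕ.* d H y

  -- Vertices of `B` or `Z` are paid for by the last summand, which is then at least `W`; for all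
  -- others `W≤` applies and `outB y` is the full degree.
  pointwise : ∀ y → W ℕ.≤ (outB y ℕ.+ intoB y) ℕ.+ W ℕ.* (𝟙 (does (B? y)) ℕ.+ 𝟙 (does (Z? y)))
  pointwise y = combine (B? y) (Z? y) (W≤ y)
    where
    -- Abstracting over the two decisions lets `does` compute in each case.
    combine : ∀ {P Q : Set} (P? : Dec P) (Q? : Dec Q) {i j} → (¬ P → ¬ Q → W ℕ.≤ i ℕ.+ j) →
              W ℕ.≤ (𝟙 (not (does P?)) ℕ.* i ℕ.+ j) ℕ.+ W ℕ.* (𝟙 (does P?) ℕ.+ 𝟙 (does Q?))
    combine (yes _) Q? {j = j} h = ℕ.≤-trans (ℕ.m≤m*n W (suc (𝟙 (does Q?)))) (ℕ.m≤n+m _ j)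
    combine (no _)  (yes _)    h = ℕ.≤-trans (ℕ.≤-reflexive (sym (ℕ.*-identityʳ W))) (ℕ.m≤n+m _ _)
    combine (no ¬p) (no ¬q) {i} {j} h = ℕ.≤-trans (h ¬p ¬q)
      (ℕ.≤-trans (ℕ.+-monoˡ-≤ j (ℕ.≤-reflexive (sym (ℕ.+-identityʳ i)))) (ℕ.m≤m+n _ _))

  -- Double counting: after exchanging the sums, each vertex of `B` collects one unit from each of
  -- its neighbours, hence its whole degree.
  ∑-intoB : sum intoB ≡ sum (λ z → 𝟙 (does (B? z)) ℕ.* d H z)
  ∑-intoB = trans (∑-comm (λ y z → 𝟙 (does (B? z)) ℕ.* 𝟙 (adj H y z)))
    (sum-cong-≗ λ z → trans (∑-*ˡ (𝟙 (does (B? z))) (λ y → 𝟙 (adj H y z)))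
      (cong (𝟙 (does (B? z)) ℕ.*_)
        (trans (sum-cong-≗ (λ y → cong 𝟙 (adj-sym H y z))) (sym (d≡∑ H z)))))

  ∑-outB-intoB : sum (λ y → outB y ℕ.+ intoB y) ≡ 2 ℕ.* e H
  ∑-outB-intoB = begin
    sum (λ y → outB y ℕ.+ intoB y)                            ≡⟨ ∑-distrib-+ outB intoB ⟩
    sum outB ℕ.+ sum intoB                                    ≡⟨ cong (sum outB ℕ.+_) ∑-intoB ⟩
    sum outB ℕ.+ sum (λ z → 𝟙 (does (B? z)) ℕ.* d H z)        ≡⟨ ∑-distrib-+ outB _ ⟨
    sum (λ y → outB y ℕ.+ 𝟙 (does (B? y)) ℕ.* d H y)
      ≡⟨ sum-cong-≗ (λ y → split (does (B? y)) (d H y)) ⟩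
    sum (d H)                                                 ≡⟨ handshake H ⟩
    2 ℕ.* e H                                                 ∎
    where
    open ≡-Reasoning
    split : ∀ b m → 𝟙 (not b) ℕ.* m ℕ.+ 𝟙 b ℕ.* m ≡ m
    split true  m = ℕ.+-identityʳ m
    split false m = trans (ℕ.+-identityʳ (m ℕ.+ 0)) (ℕ.+-identityʳ m)

  -- A union bound: besides `X` itself, each vertex of `X` of degree at most `W` brings at most `W`
  -- neighbours, and the other vertices of `X` bring none.
  ∣B∣≤ : ∣B∣ ℕ.≤ ∣ X ∣ ℕ.+ W ℕ.* ∣ X ∣
  ∣B∣≤ = begin
    ∣B∣
      ≤⟨ ∑-mono cover ⟩
    sum (λ y → 𝟙 (lookup X y) ℕ.+ sum (λ x → 𝟙 (does (lowNeighbour? y x))))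
      ≡⟨ ∑-distrib-+ (𝟙 ∘ lookup X) _ ⟩
    sum (𝟙 ∘ lookup X) ℕ.+ sum (λ y → sum (λ x → 𝟙 (does (lowNeighbour? y x))))
      ≡⟨ cong₂ ℕ._+_ (sym (∣∣≡∑ X)) (∑-comm (λ y x → 𝟙 (does (lowNeighbour? y x)))) ⟩
    ∣ X ∣ ℕ.+ sum (λ x → sum (λ y → 𝟙 (does (lowNeighbour? y x))))
      ≤⟨ ℕ.+-monoʳ-≤ ∣ X ∣ (∑-mono few) ⟩
    ∣ X ∣ ℕ.+ sum (λ x → W ℕ.* 𝟙 (lookup X x))
      ≡⟨ cong (∣ X ∣ ℕ.+_) (trans (∑-*ˡ W (𝟙 ∘ lookup X)) (cong (W ℕ.*_) (sym (∣∣≡∑ X)))) ⟩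
    ∣ X ∣ ℕ.+ W ℕ.* ∣ X ∣ ∎
    where
    open ℕ.≤-Reasoning
    member≤∑ : ∀ {m} (b : Fin m → Bool) → ∀ x → b x ≡ true → 1 ℕ.≤ sum (𝟙 ∘ b)
    member≤∑ b zero    eq rewrite eq = ℕ.s≤s ℕ.z≤n
    member≤∑ b (suc x) eq = ℕ.≤-trans (member≤∑ (b ∘ suc) x eq) (ℕ.m≤n+m _ _)

    𝟙≤ : ∀ {P : Set} (P? : Dec P) {m} → (P → 1 ℕ.≤ m) → 𝟙 (does P?) ℕ.≤ m
    𝟙≤ (yes p) h = h p
    𝟙≤ (no _)  h = ℕ.z≤n

    cover : ∀ y → 𝟙 (does (B? y)) ℕ.≤ 𝟙 (lookup X y) ℕ.+ sum (λ x → 𝟙 (does (lowNeighbour? y x)))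
    cover y = 𝟙≤ (B? y) λ
      { (inj₁ y∈X)     → ℕ.≤-trans (ℕ.≤-reflexive (cong 𝟙 (sym ([]=⇒lookup y∈X)))) (ℕ.m≤m+n _ _)
      ; (inj₂ (x , h)) → ℕ.≤-trans
          (member≤∑ (λ x → does (lowNeighbour? y x)) x (dec-true (lowNeighbour? y x) h)) (ℕ.m≤n+m _ _)
      }

    ∑-∧≤ : ∀ {P : Set} (P? : Dec P) (b : Fin n → Bool) {c} → (P → sum (𝟙 ∘ b) ℕ.≤ c) →
           sum (λ y → 𝟙 (does P? ∧ b y)) ℕ.≤ c
    ∑-∧≤ (yes p) b h = h p
    ∑-∧≤ (no _)  b h = ℕ.≤-trans (ℕ.≤-reflexive (∑-const n 0)) ℕ.z≤n

    few : ∀ x → sum (λ y → 𝟙 (does (lowNeighbour? y x))) ℕ.≤ W ℕ.* 𝟙 (lookup X x)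
    few x = ∑-∧≤ (x ∈? X ×-dec d H x ℕ.≤? W) (adj H x) λ (x∈X , low) →
      subst₂ ℕ._≤_ (d≡∑ H x)
        (trans (sym (ℕ.*-identityʳ W)) (cong (λ b → W ℕ.* 𝟙 b) (sym ([]=⇒lookup x∈X)))) low

  degree-sum : W ℕ.* n ℕ.≤ 2 ℕ.* e H ℕ.+ W ℕ.* ((∣ X ∣ ℕ.+ W ℕ.* ∣ X ∣) ℕ.+ ∣Z∣)
  degree-sum = begin
    W ℕ.* n
      ≡⟨ ∑-const n W ⟨
    sum {n} (λ _ → W)
      ≤⟨ ∑-mono pointwise ⟩
    sum (λ y → (outB y ℕ.+ intoB y) ℕ.+ W ℕ.* (𝟙 (does (B? y)) ℕ.+ 𝟙 (does (Z? y))))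
      ≡⟨ ∑-distrib-+ (λ y → outB y ℕ.+ intoB y) _ ⟩
    sum (λ y → outB y ℕ.+ intoB y) ℕ.+ sum (λ y → W ℕ.* (𝟙 (does (B? y)) ℕ.+ 𝟙 (does (Z? y))))
      ≡⟨ cong₂ ℕ._+_ ∑-outB-intoB (trans (∑-*ˡ W (λ y → 𝟙 (does (B? y)) ℕ.+ 𝟙 (does (Z? y)))) (cong (W ℕ.*_)
           (trans (∑-distrib-+ (λ y → 𝟙 (does (B? y))) (λ y → 𝟙 (does (Z? y))))
                  (cong (∣B∣ ℕ.+_) (sym (∣tabulate∣ (does ∘ Z?))))))) ⟩
    2 ℕ.* e H ℕ.+ W ℕ.* (∣B∣ ℕ.+ ∣Z∣)
      ≤⟨ ℕ.+-monoʳ-≤ (2 ℕ.* e H) (ℕ.*-monoʳ-≤ W (ℕ.+-monoˡ-≤ ∣Z∣ ∣B∣≤)) ⟩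
    2 ℕ.* e H ℕ.+ W ℕ.* ((∣ X ∣ ℕ.+ W ℕ.* ∣ X ∣) ℕ.+ ∣Z∣) ∎
    where open ℕ.≤-Reasoning

-- Vertices of least degree and separated sets

∈⇒T : {S : Subset n} {x : Fin n} → x ∈ S → T (lookup S x)
∈⇒T = ≡⇒T ∘ []=⇒lookup

T⇒∈ : {S : Subset n} {x : Fin n} → T (lookup S x) → x ∈ S
T⇒∈ {S = S} {x} h = lookup⇒[]= x S (T⇒≡ h)

⊆-insert : (r : Subset n) (i j : Fin n) → T (lookup r j) → T (lookup (r [ i ]≔ true) j)
⊆-insert (_ ∷ r) zero    zero    _ = _
⊆-insert (_ ∷ r) zero    (suc j) h = h
⊆-insert (_ ∷ r) (suc i) zero    h = h
⊆-insert (_ ∷ r) (suc i) (suc j) h = ⊆-insert r i j h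

least-outside : (f : Fin n → ℕ) (X : Subset n) → ∣ X ∣ ℕ.< n →
                ∃ λ y → y ∉ X × (∀ {z} → z ∉ X → f y ℕ.≤ f z)
least-outside {n} f X ∣X∣<n with any? (λ y → ¬? (y ∈? X))
... | no none = ⊥-elim (ℕ.<-irrefl refl (ℕ.<-≤-trans ∣X∣<n
  (subst (ℕ._≤ ∣ X ∣) (∣⊤∣≡n n)
    (p⊆q⇒∣p∣≤∣q∣ {p = ⊤} λ {x} _ → decidable-stable (x ∈? X) λ x∉X → none (x , x∉X)))))
... | yes (y₀ , y₀∉X) =
  argmin f y₀ outsiders ,
  argmin-all f y₀∉X (all-filter (λ y → ¬? (y ∈? X)) (allFin n)) ,
  λ {z} z∉X → All.lookup (f[argmin]≤f[xs] y₀ outsiders) (∈-filter⁺ (λ y → ¬? (y ∈? X)) (∈-allFin z) z∉X)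
  where outsiders = filter (λ y → ¬? (y ∈? X)) (allFin n)

-- Greedy choice: a minimiser of `f` outside the current set is inserted, and the inequality for the
-- older elements is inherited.
least-subset : (f : Fin n → ℕ) → ∀ m → m ℕ.≤ n →
               ∃ λ X → ∣ X ∣ ≡ m × (∀ {x y} → x ∈ X → y ∉ X → f x ℕ.≤ f y)
least-subset {n} f zero    m≤n = ⊥ , ∣⊥∣≡0 n , λ x∈⊥ → ⊥-elim (∉⊥-Subset x∈⊥)
least-subset     f (suc m) m<n with least-subset f m (ℕ.<⇒≤ m<n)
... | X , refl , X-least with least-outside f X m<n
...   | a , a∉X , a-least =
  X [ a ]≔ true , ∣insert∣ X a (a∉X ∘ T⇒∈) , λ {x} {y} x∈ y∉ →
    bound x (y∉ ∘ T⇒∈ ∘ ⊆-insert X a y ∘ ∈⇒T) (lookup-insert X a x (∈⇒T x∈))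
  where
  bound : ∀ x {y} → y ∉ X → T (lookup X x) ⊎ x ≡ a → f x ℕ.≤ f y
  bound x y∉X (inj₁ x∈X)  = X-least (T⇒∈ x∈X) y∉X
  bound x y∉X (inj₂ refl) = a-least y∉X

subset-of-size : (U : Subset n) → ∀ m → m ℕ.≤ ∣ U ∣ → ∃ λ S → S ⊆ U × ∣ S ∣ ≡ m
subset-of-size {n} U       zero    m≤ = ⊥ , (λ x∈⊥ → ⊥-elim (∉⊥-Subset x∈⊥)) , ∣⊥∣≡0 n
subset-of-size (true ∷ U)  (suc m) (ℕ.s≤s m≤) =
  let (S , S⊆U , ∣S∣) = subset-of-size U m m≤ in true ∷ S , s⊆s S⊆U , cong suc ∣S∣
subset-of-size (false ∷ U) (suc m) m≤ =
  let (S , S⊆U , ∣S∣) = subset-of-size U (suc m) m≤ in false ∷ S , s⊆s S⊆U , ∣S∣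

-- The condition `x ≢ y` makes the two sets disjoint, so that for two sets of size m there are m²
-- different potential edges between them.
Separated : Graph n → Subset n → Subset n → Set
Separated G X Y = ∀ {x y} → x ∈ X → y ∈ Y → x ≢ y × ¬ Adj G x y

edge-bound-or-separated :
  (G H : Graph n) (W : ℕ) →
  (∀ x y → Adj G x y → ¬ Adj H x y → W ℕ.≤ (d H x ℕ.⊔ d H y) ℕ.+ ∣ N H x ∩ N H y ∣) →
  ∀ m →
  W ℕ.* n ℕ.≤ 2 ℕ.* e H ℕ.+ W ℕ.* ((m ℕ.+ W ℕ.* m) ℕ.+ m) ⊎
  ∃₂ λ X Y → ∣ X ∣ ≡ m × ∣ Y ∣ ≡ m × Separated G X Y
edge-bound-or-separated {n} G H W heavy m with m ℕ.≤? n
-- For m > n there is no set of m vertices, but the error term already exceeds `W ℕ.* n` or equals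
-- it.
... | no m≰n = inj₁ (ℕ.≤-trans
  (ℕ.*-monoʳ-≤ W (ℕ.≤-trans (ℕ.<⇒≤ (ℕ.≰⇒> m≰n)) (ℕ.m≤n+m m (m ℕ.+ W ℕ.* m)))) (ℕ.m≤n+m _ (2 ℕ.* e H)))
... | yes m≤n with least-subset (d H) m m≤n
...   | X , refl , X-least = split (∣ X ∣ ℕ.≤? ∣Z∣)
  where
  open Counting G H W heavy X X-least
  Zs : Subset n
  Zs = tabulate (does ∘ Z?)

  Z⁻ : ∀ {y} → y ∈ Zs → Z y
  Z⁻ {y} y∈ = toWitness {a? = Z? y} (≡⇒T (trans (isYes≗does (Z? y))
    (trans (sym (lookup∘tabulate (does ∘ Z?) y)) ([]=⇒lookup y∈))))

  split : Dec (∣ X ∣ ℕ.≤ ∣Z∣) → _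
  split (no few) = inj₁ (ℕ.≤-trans degree-sum
    (ℕ.+-monoʳ-≤ (2 ℕ.* e H) (ℕ.*-monoʳ-≤ W (ℕ.+-monoʳ-≤ (∣ X ∣ ℕ.+ W ℕ.* ∣ X ∣) (ℕ.<⇒≤ (ℕ.≰⇒> few))))))
  split (yes many) with subset-of-size Zs ∣ X ∣ many
  ... | Y , Y⊆Z , ∣Y∣ = inj₂ (X , Y , refl , ∣Y∣ , λ {x} {y} x∈X y∈Y →
    -- `Y` avoids `B`, which contains `X`, so the sets are disjoint; membership in `Z` excludes the
    -- edges of `G`.
    let (¬By , none) = Z⁻ (Y⊆Z y∈Y) in (λ { refl → ¬By (inj₁ x∈X) }) , λ xy → none x (x∈X , xy))

-- Rational numbers

-- A normalised fraction does not compute for a variable `m`, so the arithmetic of `fromℕ` is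
-- verified on unnormalised rationals.
toℚᵘ-fromℕ : ∀ m → ℚ.toℚᵘ (fromℕ m) ℚᵘ.≃ mkℚᵘ (ℤ.+ m) 0
toℚᵘ-fromℕ m = ℚ.toℚᵘ-fromℚᵘ (mkℚᵘ (ℤ.+ m) 0)

fromℕ-+ : ∀ a b → fromℕ (a ℕ.+ b) ≡ fromℕ a + fromℕ b
fromℕ-+ a b = ℚ.toℚᵘ-injective (begin
  ℚ.toℚᵘ (fromℕ (a ℕ.+ b))                     ≈⟨ toℚᵘ-fromℕ (a ℕ.+ b) ⟩
  mkℚᵘ (ℤ.+ (a ℕ.+ b)) 0                       ≈⟨ ℚᵘ.*≡* (cong (ℤ._* ℤ.+ 1)
      (cong₂ ℤ._+_ (sym (ℤ.*-identityʳ (ℤ.+ a))) (sym (ℤ.*-identityʳ (ℤ.+ b))))) ⟩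
  mkℚᵘ (ℤ.+ a) 0 ℚᵘ.+ mkℚᵘ (ℤ.+ b) 0           ≈⟨ ℚᵘ.+-cong (toℚᵘ-fromℕ a) (toℚᵘ-fromℕ b) ⟨
  ℚ.toℚᵘ (fromℕ a) ℚᵘ.+ ℚ.toℚᵘ (fromℕ b)       ≈⟨ ℚ.toℚᵘ-homo-+ (fromℕ a) (fromℕ b) ⟨
  ℚ.toℚᵘ (fromℕ a + fromℕ b)                   ∎)
  where open ℚᵘ.≃-Reasoning

fromℕ-* : ∀ a b → fromℕ (a ℕ.* b) ≡ fromℕ a * fromℕ b
fromℕ-* a b = ℚ.toℚᵘ-injective (begin
  ℚ.toℚᵘ (fromℕ (a ℕ.* b))                     ≈⟨ toℚᵘ-fromℕ (a ℕ.* b) ⟩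
  mkℚᵘ (ℤ.+ (a ℕ.* b)) 0                       ≈⟨ ℚᵘ.*≡* (cong (ℤ._* ℤ.+ 1) (ℤ.pos-* a b)) ⟩
  mkℚᵘ (ℤ.+ a) 0 ℚᵘ.* mkℚᵘ (ℤ.+ b) 0           ≈⟨ ℚᵘ.*-cong (toℚᵘ-fromℕ a) (toℚᵘ-fromℕ b) ⟨
  ℚ.toℚᵘ (fromℕ a) ℚᵘ.* ℚ.toℚᵘ (fromℕ b)       ≈⟨ ℚ.toℚᵘ-homo-* (fromℕ a) (fromℕ b) ⟨
  ℚ.toℚᵘ (fromℕ a * fromℕ b)                   ∎)
  where open ℚᵘ.≃-Reasoning

fromℕ-mono-≤ : ∀ {a b} → a ℕ.≤ b → fromℕ a ≤ fromℕ b
fromℕ-mono-≤ {a} {b} a≤b = ℚ.toℚᵘ-cancel-≤ (begin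
  ℚ.toℚᵘ (fromℕ a)  ≃⟨ toℚᵘ-fromℕ a ⟩
  mkℚᵘ (ℤ.+ a) 0    ≤⟨ ℚᵘ.*≤* (ℤ.*-monoʳ-≤-nonNeg (ℤ.+ 1) (ℤ.+≤+ a≤b)) ⟩
  mkℚᵘ (ℤ.+ b) 0    ≃⟨ toℚᵘ-fromℕ b ⟨
  ℚ.toℚᵘ (fromℕ b)  ∎)
  where open ℚᵘ.≤-Reasoning

0≤fromℕ : ∀ a → 0ℚ ≤ fromℕ a
0≤fromℕ a = fromℕ-mono-≤ {0} {a} ℕ.z≤n

*-monoˡ : ∀ {a b c} → 0ℚ ≤ c → a ≤ b → c * a ≤ c * b
*-monoˡ {c = c} 0≤c = ℚ.*-monoˡ-≤-nonNeg c {{ℚ.nonNegative 0≤c}}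

*-monoʳ : ∀ {a b c} → 0ℚ ≤ c → a ≤ b → a * c ≤ b * c
*-monoʳ {c = c} 0≤c = ℚ.*-monoʳ-≤-nonNeg c {{ℚ.nonNegative 0≤c}}

0≤* : ∀ {a b} → 0ℚ ≤ a → 0ℚ ≤ b → 0ℚ ≤ a * b
0≤* {a} {b} 0≤a 0≤b = subst (_≤ a * b) (ℚ.*-zeroʳ a) (*-monoˡ 0≤a 0≤b)

*-mono : ∀ {a b c d} → 0ℚ ≤ c → 0ℚ ≤ b → a ≤ b → c ≤ d → a * c ≤ b * d
*-mono 0≤c 0≤b a≤b c≤d = ℚ.≤-trans (*-monoʳ 0≤c a≤b) (*-monoˡ 0≤b c≤d)

0≤1 : 0ℚ ≤ 1ℚ
0≤1 = ℚ.nonNegative⁻¹ 1ℚ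

p≤q⇒0≤q-p : ∀ {p q} → p ≤ q → 0ℚ ≤ q - p
p≤q⇒0≤q-p {p} {q} p≤q = subst (_≤ q - p) (ℚ.+-inverseʳ p) (ℚ.+-monoˡ-≤ (- p) p≤q)

1-p≤1 : ∀ {p} → 0ℚ ≤ p → 1ℚ - p ≤ 1ℚ
1-p≤1 {p} 0≤p = subst (1ℚ - p ≤_) (ℚ.+-identityʳ 1ℚ) (ℚ.+-monoʳ-≤ 1ℚ (ℚ.neg-antimono-≤ 0≤p))

½≤1 : ½ ≤ 1ℚ
½≤1 = ℚ.*≤* (ℤ.+≤+ (ℕ.s≤s ℕ.z≤n))

0≤½ : 0ℚ ≤ ½
0≤½ = ℚ.nonNegative⁻¹ ½

0≤^ : ∀ {s} m → 0ℚ ≤ s → 0ℚ ≤ s ^ m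
0≤^ zero    0≤s = 0≤1
0≤^ (suc m) 0≤s = 0≤* 0≤s (0≤^ m 0≤s)

^-monoˡ : ∀ {s t} m → 0ℚ ≤ s → s ≤ t → s ^ m ≤ t ^ m
^-monoˡ zero    0≤s s≤t = ℚ.≤-refl
^-monoˡ (suc m) 0≤s s≤t = *-mono (0≤^ m 0≤s) (ℚ.≤-trans 0≤s s≤t) s≤t (^-monoˡ m 0≤s s≤t)

^≤1 : ∀ {s} m → 0ℚ ≤ s → s ≤ 1ℚ → s ^ m ≤ 1ℚ
^≤1 zero    0≤s s≤1 = ℚ.≤-refl
^≤1 (suc m) 0≤s s≤1 = *-mono (0≤^ m 0≤s) 0≤1 s≤1 (^≤1 m 0≤s s≤1)

^-antimono : ∀ {s l m} → 0ℚ ≤ s → s ≤ 1ℚ → l ℕ.≤ m → s ^ m ≤ s ^ l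
^-antimono {m = m} 0≤s s≤1 ℕ.z≤n       = ^≤1 m 0≤s s≤1
^-antimono         0≤s s≤1 (ℕ.s≤s l≤m) = *-monoˡ 0≤s (^-antimono 0≤s s≤1 l≤m)

fromℕ-^ : ∀ a m → fromℕ (a ℕ.^ m) ≡ fromℕ a ^ m
fromℕ-^ a zero    = refl
fromℕ-^ a (suc m) = trans (fromℕ-* a (a ℕ.^ m)) (cong (fromℕ a *_) (fromℕ-^ a m))

-- The denominator serves as the multiple: it turns `x` into its numerator, a positive integer.
archimedean : ∀ x → .{{ℚ.Positive x}} → ∃ λ c → 1ℚ ≤ fromℕ c * x
archimedean x@(ℚ.mkℚ (ℤ.+[1+ a ]) b _) = suc b , ℚ.toℚᵘ-cancel-≤ (begin
  mkℚᵘ (ℤ.+ 1) 0                             ≤⟨ ℚᵘ.*≤* (ℤ.+≤+ (subst₂ ℕ._≤_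
      (cong suc (sym (trans (ℕ.+-identityʳ _) (ℕ.+-identityʳ b)))) (sym (ℕ.*-identityʳ _))
      (ℕ.m≤m*n (suc b) (suc a)))) ⟩
  mkℚᵘ (ℤ.+ suc b) 0 ℚᵘ.* ℚ.toℚᵘ x           ≃⟨ ℚᵘ.*-congʳ {ℚ.toℚᵘ x} (toℚᵘ-fromℕ (suc b)) ⟨
  ℚ.toℚᵘ (fromℕ (suc b)) ℚᵘ.* ℚ.toℚᵘ x       ≃⟨ ℚ.toℚᵘ-homo-* (fromℕ (suc b)) x ⟨
  ℚ.toℚᵘ (fromℕ (suc b) * x)                 ∎)
  where open ℚᵘ.≤-Reasoning

-- Bernoulli's inequality for 1/(1 - a), cleared of denominators.
bernoulli : ∀ {a} → 0ℚ ≤ a → a ≤ 1ℚ → ∀ c → (1ℚ - a) ^ c * (1ℚ + fromℕ c * a) ≤ 1ℚ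
bernoulli {a} 0≤a a≤1 zero    = ℚ.≤-reflexive
  (trans (ℚ.*-identityˡ _) (trans (cong (1ℚ +_) (ℚ.*-zeroˡ a)) (ℚ.+-identityʳ 1ℚ)))
bernoulli {a} 0≤a a≤1 (suc c) = begin
  ((1ℚ - a) * P) * (1ℚ + fromℕ (suc c) * a)
    ≡⟨ cong (λ z → ((1ℚ - a) * P) * (1ℚ + z * a)) (fromℕ-+ 1 c) ⟩
  ((1ℚ - a) * P) * (1ℚ + (1ℚ + C) * a)
    ≡⟨ expand a P C ⟩
  P * (1ℚ + C * a) - (P * (1ℚ + C)) * (a * a)
    ≤⟨ ℚ.+-monoʳ-≤ (P * (1ℚ + C * a)) (ℚ.neg-antimono-≤
         (0≤* (0≤* (0≤^ c (p≤q⇒0≤q-p a≤1)) (subst (0ℚ ≤_) (fromℕ-+ 1 c) (0≤fromℕ (suc c)))) (0≤* 0≤a 0≤a))) ⟩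
  P * (1ℚ + C * a) - 0ℚ
    ≡⟨ ℚ.+-identityʳ _ ⟩
  P * (1ℚ + C * a)
    ≤⟨ bernoulli 0≤a a≤1 c ⟩
  1ℚ ∎
  where
  open ℚ.≤-Reasoning
  P C : ℚ
  P = (1ℚ - a) ^ c
  C = fromℕ c
  expand : ∀ a P C → ((1ℚ - a) * P) * (1ℚ + (1ℚ + C) * a) ≡ P * (1ℚ + C * a) - (P * (1ℚ + C)) * (a * a)
  expand = solve 3 (λ a P C → ((con 1ℚ :- a) :* P) :* (con 1ℚ :+ (con 1ℚ :+ C) :* a)
                              := P :* (con 1ℚ :+ C :* a) :- (P :* (con 1ℚ :+ C)) :* (a :* a)) refl
    where open +-*-Solver

-- By Bernoulli, (1 - a)^c is at most 1/(1 + c a). With c chosen so that c a ε ≥ 1, also ε (1 + c a)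
-- ≥ 1, and larger exponents only decrease the power.
^-vanishes : ∀ {a ε} → 0ℚ < a → a ≤ 1ℚ → 0ℚ < ε → ∃ λ c → ∀ m → c ℕ.≤ m → (1ℚ - a) ^ m ≤ ε
^-vanishes {a} {ε} 0<a a≤1 0<ε =
  let (c , 1≤) = archimedean (a * ε) {{ℚ.pos*pos⇒pos a {{ℚ.positive 0<a}} ε {{ℚ.positive 0<ε}}}}
      P = (1ℚ - a) ^ c
      open ℚ.≤-Reasoning
  in c , λ m c≤m → begin
    (1ℚ - a) ^ m                        ≤⟨ ^-antimono 0≤1-a (1-p≤1 (ℚ.<⇒≤ 0<a)) c≤m ⟩
    P                                   ≡⟨ ℚ.*-identityʳ P ⟨
    P * 1ℚ                              ≤⟨ *-monoˡ (0≤^ c 0≤1-a) 1≤ ⟩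
    P * (fromℕ c * (a * ε))
      ≤⟨ *-monoˡ (0≤^ c 0≤1-a)
        (subst (_≤ ε + fromℕ c * (a * ε)) (ℚ.+-identityˡ _) (ℚ.+-monoˡ-≤ (fromℕ c * (a * ε)) (ℚ.<⇒≤ 0<ε))) ⟩
    P * (ε + fromℕ c * (a * ε))         ≡⟨ regroup P (fromℕ c) a ε ⟩
    (P * (1ℚ + fromℕ c * a)) * ε        ≤⟨ *-monoʳ (ℚ.<⇒≤ 0<ε) (bernoulli (ℚ.<⇒≤ 0<a) a≤1 c) ⟩
    1ℚ * ε                              ≡⟨ ℚ.*-identityˡ ε ⟩
    ε                                   ∎
  where
  0≤1-a = p≤q⇒0≤q-p a≤1
  regroup : ∀ P c a ε → P * (ε + c * (a * ε)) ≡ (P * (1ℚ + c * a)) * ε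
  regroup = solve 4 (λ P c a ε → P :* (ε :+ c :* (a :* ε)) := (P :* (con 1ℚ :+ c :* a)) :* ε) refl
    where open +-*-Solver

-- Random graphs

∑ˡ : List I → (I → ℚ) → ℚ
∑ˡ xs f = foldr _+_ 0ℚ (map f xs)

∑ˡ-cong : ∀ (xs : List I) {f g : I → ℚ} → (∀ x → f x ≡ g x) → ∑ˡ xs f ≡ ∑ˡ xs g
∑ˡ-cong xs f≗g = cong (foldr _+_ 0ℚ) (map-cong f≗g xs)

∑ˡ-mono : ∀ (xs : List I) {f g : I → ℚ} → (∀ {x} → x ∈ˡ xs → f x ≤ g x) → ∑ˡ xs f ≤ ∑ˡ xs g
∑ˡ-mono []       f≤g = ℚ.≤-refl
∑ˡ-mono (x ∷ xs) f≤g = ℚ.+-mono-≤ (f≤g (hereˡ refl)) (∑ˡ-mono xs (f≤g ∘ thereˡ))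

0≤∑ˡ : ∀ (xs : List I) {f : I → ℚ} → (∀ x → 0ℚ ≤ f x) → 0ℚ ≤ ∑ˡ xs f
0≤∑ˡ []       0≤f = ℚ.≤-refl
0≤∑ˡ (x ∷ xs) 0≤f = ℚ.+-mono-≤ (0≤f x) (0≤∑ˡ xs 0≤f)

∑ˡ-++ : ∀ (xs ys : List I) (f : I → ℚ) → ∑ˡ (xs ++ ys) f ≡ ∑ˡ xs f + ∑ˡ ys f
∑ˡ-++ []       ys f = sym (ℚ.+-identityˡ _)
∑ˡ-++ (x ∷ xs) ys f = trans (cong (f x +_) (∑ˡ-++ xs ys f)) (sym (ℚ.+-assoc (f x) (∑ˡ xs f) (∑ˡ ys f)))

∑ˡ-map : ∀ (g : I → I′) xs (f : I′ → ℚ) → ∑ˡ (map g xs) f ≡ ∑ˡ xs (f ∘ g)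
∑ˡ-map g xs f = cong (foldr _+_ 0ℚ) (sym (map-∘ xs))

∑ˡ-distrib-+ : ∀ (xs : List I) (f g : I → ℚ) → ∑ˡ xs (λ x → f x + g x) ≡ ∑ˡ xs f + ∑ˡ xs g
∑ˡ-distrib-+ []       f g = refl
∑ˡ-distrib-+ (x ∷ xs) f g = trans (cong (f x + g x +_) (∑ˡ-distrib-+ xs f g))
  (solve 4 (λ a b c d → (a :+ b) :+ (c :+ d) := (a :+ c) :+ (b :+ d)) refl (f x) (g x) (∑ˡ xs f) (∑ˡ xs g))
  where open +-*-Solver

∑ˡ-*ˡ : ∀ c (xs : List I) (f : I → ℚ) → ∑ˡ xs (λ x → c * f x) ≡ c * ∑ˡ xs f
∑ˡ-*ˡ c []       f = sym (ℚ.*-zeroʳ c)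
∑ˡ-*ˡ c (x ∷ xs) f = trans (cong (c * f x +_) (∑ˡ-*ˡ c xs f)) (sym (ℚ.*-distribˡ-+ c (f x) (∑ˡ xs f)))

∑ˡ-*ʳ : ∀ c (xs : List I) (f : I → ℚ) → ∑ˡ xs (λ x → f x * c) ≡ ∑ˡ xs f * c
∑ˡ-*ʳ c xs f = trans (∑ˡ-cong xs λ x → ℚ.*-comm (f x) c) (trans (∑ˡ-*ˡ c xs f) (ℚ.*-comm c (∑ˡ xs f)))

∑ˡ-const : ∀ (xs : List I) c → ∑ˡ xs (λ _ → c) ≡ fromℕ (length xs) * c
∑ˡ-const []       c = sym (ℚ.*-zeroˡ c)
∑ˡ-const (x ∷ xs) c = begin
  c + ∑ˡ xs (λ _ → c)               ≡⟨ cong₂ _+_ (sym (ℚ.*-identityˡ c)) (∑ˡ-const xs c) ⟩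
  1ℚ * c + fromℕ (length xs) * c    ≡⟨ ℚ.*-distribʳ-+ c 1ℚ (fromℕ (length xs)) ⟨
  (1ℚ + fromℕ (length xs)) * c      ≡⟨ cong (_* c) (fromℕ-+ 1 (length xs)) ⟨
  fromℕ (suc (length xs)) * c       ∎
  where open ≡-Reasoning

∑ˡ-comm : ∀ (xs : List I) (ys : List I′) (f : I → I′ → ℚ) →
          ∑ˡ xs (λ x → ∑ˡ ys (f x)) ≡ ∑ˡ ys (λ y → ∑ˡ xs (λ x → f x y))
∑ˡ-comm []       ys f = sym (trans (∑ˡ-const ys 0ℚ) (ℚ.*-zeroʳ (fromℕ (length ys))))
∑ˡ-comm (x ∷ xs) ys f = trans (cong (∑ˡ ys (f x) +_) (∑ˡ-comm xs ys f))
  (sym (∑ˡ-distrib-+ ys (f x) (λ y → ∑ˡ xs (λ x → f x y))))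

∑ˡ-cartesianProductWith : ∀ (g : I → I′ → I″) xs ys (f : I″ → ℚ) →
  ∑ˡ (cartesianProductWith g xs ys) f ≡ ∑ˡ xs (λ x → ∑ˡ ys (λ y → f (g x y)))
∑ˡ-cartesianProductWith g []       ys f = refl
∑ˡ-cartesianProductWith g (x ∷ xs) ys f = trans (∑ˡ-++ (map (g x) ys) (cartesianProductWith g xs ys) f)
  (cong₂ _+_ (∑ˡ-map (g x) ys f) (∑ˡ-cartesianProductWith g xs ys f))

rowWeight : ℚ → Subset n → ℚ
rowWeight q []          = 1ℚ
rowWeight q (true ∷ r)  = q * rowWeight q r
rowWeight q (false ∷ r) = (1ℚ - q) * rowWeight q r

weightℚ : ℚ → Graph n → ℚ
weightℚ q []      = 1ℚ
weightℚ q (r ∷ G) = rowWeight q r * weightℚ q G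

-- Arithmetic on `ℝ` is termwise, so each term of the sequence is the probability of the graph at
-- edge probability `seq p i`. All estimates can thus be made in ℚ.
seq-weight : ∀ p i (G : Graph n) → seq (weight p G) i ≡ weightℚ (seq p i) G
seq-weight p i []      = refl
seq-weight p i (r ∷ G) = trans (row r) (cong (rowWeight (seq p i) r *_) (seq-weight p i G))
  where
  row : ∀ {m} (r : Subset m) →
        seq (Vec.foldr′ (λ b t → (if b then p else 1ℝ -ℝ p) *ℝ t) (weight p G) r) i
          ≡ rowWeight (seq p i) r * seq (weight p G) i
  row []          = sym (ℚ.*-identityˡ _)
  row (true ∷ r)  = trans (cong (seq p i *_) (row r)) (sym (ℚ.*-assoc (seq p i) (rowWeight (seq p i) r) _))
  row (false ∷ r) = trans (cong ((1ℚ - seq p i) *_) (row r))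
                          (sym (ℚ.*-assoc (1ℚ - seq p i) (rowWeight (seq p i) r) _))

seq-∑ℝ : ∀ p i (Gs : List (Graph n)) → seq (∑ℝ (map (weight p) Gs)) i ≡ ∑ˡ Gs (weightℚ (seq p i))
seq-∑ℝ p i []       = refl
seq-∑ℝ p i (G ∷ Gs) = cong₂ _+_ (seq-weight p i G) (seq-∑ℝ p i Gs)

-- The indicator of the event that r and s (K and G) are disjoint, written as a product over the
-- potential elements (edges) so that its expectation factorises.
missRow : Subset n → Subset n → ℚ
missRow []          []          = 1ℚ
missRow (true ∷ r)  (true ∷ s)  = 0ℚ
missRow (true ∷ r)  (false ∷ s) = missRow r s
missRow (false ∷ r) (_ ∷ s)     = missRow r s

miss : Graph n → Graph n → ℚ
miss []      []      = 1ℚ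
miss (r ∷ K) (s ∷ G) = missRow r s * miss K G

missRow≡1 : (r s : Subset n) → (∀ {i} → i ∈ r → i ∉ s) → missRow r s ≡ 1ℚ
missRow≡1 []          []          h = refl
missRow≡1 (true ∷ r)  (true ∷ s)  h = ⊥-elim (h here here)
missRow≡1 (true ∷ r)  (false ∷ s) h = missRow≡1 r s (λ i∈r i∈s → h (there i∈r) (there i∈s))
missRow≡1 (false ∷ r) (_ ∷ s)     h = missRow≡1 r s (λ i∈r i∈s → h (there i∈r) (there i∈s))

0≤missRow : (r s : Subset n) → 0ℚ ≤ missRow r s
0≤missRow []          []          = 0≤1
0≤missRow (true ∷ r)  (true ∷ s)  = ℚ.≤-refl
0≤missRow (true ∷ r)  (false ∷ s) = 0≤missRow r s
0≤missRow (false ∷ r) (_ ∷ s)     = 0≤missRow r s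

0≤miss : (K G : Graph n) → 0ℚ ≤ miss K G
0≤miss []      []      = 0≤1
0≤miss (r ∷ K) (s ∷ G) = 0≤* (0≤missRow r s) (0≤miss K G)

∑ˡ-subsets : ∀ n (f : Subset (suc n) → ℚ) →
             ∑ˡ (subsets (suc n)) f ≡
             ∑ˡ (subsets n) (λ r → f (true ∷ r)) + ∑ˡ (subsets n) (λ r → f (false ∷ r))
∑ˡ-subsets n f = trans (∑ˡ-cartesianProductWith _∷_ (true ∷ false ∷ []) (subsets n) f)
  (cong (∑ˡ (subsets n) (λ r → f (true ∷ r)) +_) (ℚ.+-identityʳ _))

-- An element of `r` has to be absent from the random set, which costs a factor 1 - q; any other
-- element is free and contributes q + (1 - q) = 1.
∑-missRow : ∀ q (r : Subset n) → ∑ˡ (subsets n) (λ s → rowWeight q s * missRow r s) ≡ (1ℚ - q) ^ ∣ r ∣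
∑-missRow q [] = refl
∑-missRow {suc n} q (true ∷ r) = begin
  ∑ˡ (subsets (suc n)) (λ s → rowWeight q s * missRow (true ∷ r) s)
    ≡⟨ ∑ˡ-subsets n (λ s → rowWeight q s * missRow (true ∷ r) s) ⟩
  ∑ˡ (subsets n) (λ s → (q * rowWeight q s) * 0ℚ) +
  ∑ˡ (subsets n) (λ s → ((1ℚ - q) * rowWeight q s) * missRow r s)
    ≡⟨ cong₂ _+_
         (trans (∑ˡ-*ʳ 0ℚ (subsets n) (λ s → q * rowWeight q s))
           (ℚ.*-zeroʳ (∑ˡ (subsets n) (λ s → q * rowWeight q s))))
         (trans (∑ˡ-cong (subsets n) (λ s → ℚ.*-assoc (1ℚ - q) (rowWeight q s) (missRow r s)))
                (trans (∑ˡ-*ˡ (1ℚ - q) (subsets n) _) (cong ((1ℚ - q) *_) (∑-missRow q r)))) ⟩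
  0ℚ + (1ℚ - q) * (1ℚ - q) ^ ∣ r ∣
    ≡⟨ ℚ.+-identityˡ _ ⟩
  (1ℚ - q) ^ suc ∣ r ∣ ∎
  where open ≡-Reasoning
∑-missRow {suc n} q (false ∷ r) = begin
  ∑ˡ (subsets (suc n)) (λ s → rowWeight q s * missRow (false ∷ r) s)
    ≡⟨ ∑ˡ-subsets n (λ s → rowWeight q s * missRow (false ∷ r) s) ⟩
  ∑ˡ (subsets n) (λ s → (q * rowWeight q s) * missRow r s) +
  ∑ˡ (subsets n) (λ s → ((1ℚ - q) * rowWeight q s) * missRow r s)
    ≡⟨ cong₂ _+_ (pull q) (pull (1ℚ - q)) ⟩
  q * (1ℚ - q) ^ ∣ r ∣ + (1ℚ - q) * (1ℚ - q) ^ ∣ r ∣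
    ≡⟨ solve 2 (λ q P → q :* P :+ (con 1ℚ :- q) :* P := P) refl q ((1ℚ - q) ^ ∣ r ∣) ⟩
  (1ℚ - q) ^ ∣ r ∣ ∎
  where
  open ≡-Reasoning
  open +-*-Solver
  pull : ∀ c → ∑ˡ (subsets n) (λ s → (c * rowWeight q s) * missRow r s) ≡ c * (1ℚ - q) ^ ∣ r ∣
  pull c = trans (∑ˡ-cong (subsets n) (λ s → ℚ.*-assoc c (rowWeight q s) (missRow r s)))
                 (trans (∑ˡ-*ˡ c (subsets n) _) (cong (c *_) (∑-missRow q r)))

-- Rows are independent: weight and indicator are both products over rows, so the double sum
-- factorises and the exponents add up to `e K`.
∑-miss : ∀ q (K : Graph n) → ∑ˡ (graphs n) (λ G → weightℚ q G * miss K G) ≡ (1ℚ - q) ^ e K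
∑-miss q [] = refl
∑-miss {suc n} q (r ∷ K) = begin
  ∑ˡ (graphs (suc n)) (λ G → weightℚ q G * miss (r ∷ K) G)
    ≡⟨ ∑ˡ-cartesianProductWith _∷_ (subsets n) (graphs n) (λ G → weightℚ q G * miss (r ∷ K) G) ⟩
  ∑ˡ (subsets n) (λ s → ∑ˡ (graphs n) (λ G → (rowWeight q s * weightℚ q G) * (missRow r s * miss K G)))
    ≡⟨ ∑ˡ-cong (subsets n) (λ s →
         trans (∑ˡ-cong (graphs n) λ G → interchange (rowWeight q s) (weightℚ q G) (missRow r s) (miss K G))
         (trans (∑ˡ-*ˡ (rowWeight q s * missRow r s) (graphs n) (λ G → weightℚ q G * miss K G))
                (cong (rowWeight q s * missRow r s *_) (∑-miss q K)))) ⟩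
  ∑ˡ (subsets n) (λ s → (rowWeight q s * missRow r s) * (1ℚ - q) ^ e K)
    ≡⟨ ∑ˡ-*ʳ ((1ℚ - q) ^ e K) (subsets n) (λ s → rowWeight q s * missRow r s) ⟩
  ∑ˡ (subsets n) (λ s → rowWeight q s * missRow r s) * (1ℚ - q) ^ e K
    ≡⟨ cong (_* (1ℚ - q) ^ e K) (∑-missRow q r) ⟩
  (1ℚ - q) ^ ∣ r ∣ * (1ℚ - q) ^ e K
    ≡⟨ ^-homo-* (1ℚ - q) ∣ r ∣ (e K) ⟨
  (1ℚ - q) ^ (∣ r ∣ ℕ.+ e K) ∎
  where
  open ≡-Reasoning
  interchange : ∀ a b c d → (a * b) * (c * d) ≡ (a * c) * (b * d)
  interchange = solve 4 (λ a b c d → (a :* b) :* (c :* d) := (a :* c) :* (b :* d)) refl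
    where open +-*-Solver

miss-edgeless : (G : Graph n) → miss (edgeless n) G ≡ 1ℚ
miss-edgeless []      = refl
miss-edgeless (s ∷ G) = cong₂ _*_ (missRow≡1 ⊥ s λ i∈⊥ → ⊥-elim (∉⊥-Subset i∈⊥)) (miss-edgeless G)

e-edgeless : ∀ n → e (edgeless n) ≡ 0
e-edgeless zero    = refl
e-edgeless (suc n) = cong₂ ℕ._+_ (∣⊥∣≡0 n) (e-edgeless n)

-- Total mass 1 is the case of an edgeless graph in `∑-miss`, an event that always occurs.
∑-weight : ∀ n q → ∑ˡ (graphs n) (weightℚ q) ≡ 1ℚ
∑-weight n q = begin
  ∑ˡ (graphs n) (weightℚ q)
    ≡⟨ ∑ˡ-cong (graphs n) (λ G → ℚ.*-identityʳ (weightℚ q G)) ⟨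
  ∑ˡ (graphs n) (λ G → weightℚ q G * 1ℚ)
    ≡⟨ ∑ˡ-cong (graphs n) (λ G → cong (weightℚ q G *_) (miss-edgeless G)) ⟨
  ∑ˡ (graphs n) (λ G → weightℚ q G * miss (edgeless n) G)    ≡⟨ ∑-miss q (edgeless n) ⟩
  (1ℚ - q) ^ e (edgeless n)                                  ≡⟨ cong ((1ℚ - q) ^_) (e-edgeless n) ⟩
  1ℚ                                                         ∎
  where open ≡-Reasoning

-- The union bound

module Probability {q : ℚ} (0≤q : 0ℚ ≤ q) (0≤1-q : 0ℚ ≤ 1ℚ - q) (1-q≤1 : 1ℚ - q ≤ 1ℚ) where

  0≤rowWeight : (r : Subset n) → 0ℚ ≤ rowWeight q r
  0≤rowWeight []          = 0≤1
  0≤rowWeight (true ∷ r)  = 0≤* 0≤q (0≤rowWeight r)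
  0≤rowWeight (false ∷ r) = 0≤* 0≤1-q (0≤rowWeight r)

  0≤weight : (G : Graph n) → 0ℚ ≤ weightℚ q G
  0≤weight []      = 0≤1
  0≤weight (r ∷ G) = 0≤* (0≤rowWeight r) (0≤weight G)

  module _ {A : Graph n → Set} (A? : Decidable A) where

    ∑-filter≤ : ∀ Gs → ∑ˡ (filter A? Gs) (weightℚ q) ≤ ∑ˡ Gs (weightℚ q)
    ∑-filter≤ []       = ℚ.≤-refl
    ∑-filter≤ (G ∷ Gs) with does (A? G)
    ... | true  = ℚ.+-monoʳ-≤ (weightℚ q G) (∑-filter≤ Gs)
    ... | false = subst (_≤ weightℚ q G + ∑ˡ Gs (weightℚ q)) (ℚ.+-identityˡ _)
                    (ℚ.+-mono-≤ (0≤weight G) (∑-filter≤ Gs))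

    ℙ≤1 : ∑ˡ (filter A? (graphs n)) (weightℚ q) ≤ 1ℚ
    ℙ≤1 = subst (∑ˡ (filter A? (graphs n)) (weightℚ q) ≤_) (∑-weight n q) (∑-filter≤ (graphs n))

    module _ (Ks : List (Graph n)) (bad : ∀ G → ¬ A G → ∃ λ K → K ∈ˡ Ks × miss K G ≡ 1ℚ) where

      misses : Graph n → ℚ
      misses G = ∑ˡ Ks (λ K → miss K G)

      1≤misses : ∀ G → ¬ A G → 1ℚ ≤ misses G
      1≤misses G ¬AG with bad G ¬AG
      ... | K , K∈ , eq = subst (_≤ misses G) eq (member≤∑ Ks K∈)
        where
        member≤∑ : ∀ Ks → K ∈ˡ Ks → miss K G ≤ ∑ˡ Ks (λ K → miss K G)
        member≤∑ (K ∷ Ks) (hereˡ refl) = subst (_≤ miss K G + ∑ˡ Ks (λ K → miss K G)) (ℚ.+-identityʳ _)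
          (ℚ.+-monoʳ-≤ (miss K G) (0≤∑ˡ Ks (λ K → 0≤miss K G)))
        member≤∑ (K′ ∷ Ks) (thereˡ K∈) = subst (_≤ miss K′ G + ∑ˡ Ks (λ K → miss K G)) (ℚ.+-identityˡ _)
          (ℚ.+-mono-≤ (0≤miss K′ G) (member≤∑ Ks K∈))

      -- Markov's inequality: a graph outside `A` has `misses` at least 1, so its weight is covered
      -- by its term in the second sum.
      ∑≤filter+bad : ∀ Gs → ∑ˡ Gs (weightℚ q) ≤
                     ∑ˡ (filter A? Gs) (weightℚ q) + ∑ˡ Gs (λ G → weightℚ q G * misses G)
      ∑≤filter+bad []       = ℚ.≤-refl
      ∑≤filter+bad (G ∷ Gs) with A? G
      ... | yes _ = begin
        w₀ + ∑ˡ Gs (weightℚ q)          ≤⟨ ℚ.+-monoʳ-≤ w₀ (∑≤filter+bad Gs) ⟩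
        w₀ + (S + R)                    ≡⟨ ℚ.+-assoc w₀ S R ⟨
        (w₀ + S) + R                    ≡⟨ cong ((w₀ + S) +_) (ℚ.+-identityˡ R) ⟨
        (w₀ + S) + (0ℚ + R)             ≤⟨ ℚ.+-monoʳ-≤ (w₀ + S) (ℚ.+-monoˡ-≤ R (0≤* (0≤weight G) (0≤∑ˡ Ks (λ K → 0≤miss K G)))) ⟩
        (w₀ + S) + (w₀ * misses G + R)  ∎
        where
        open ℚ.≤-Reasoning
        w₀ = weightℚ q G
        S = ∑ˡ (filter A? Gs) (weightℚ q)
        R = ∑ˡ Gs (λ G → weightℚ q G * misses G)
      ... | no ¬AG = begin
        w₀ + ∑ˡ Gs (weightℚ q)
          ≤⟨ ℚ.+-mono-≤ (subst (_≤ w₀ * misses G) (ℚ.*-identityʳ w₀)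
               (*-monoˡ (0≤weight G) (1≤misses G ¬AG))) (∑≤filter+bad Gs) ⟩
        w₀ * misses G + (S + R)
          ≡⟨ solve 3 (λ a b c → a :+ (b :+ c) := b :+ (a :+ c)) refl (w₀ * misses G) S R ⟩
        S + (w₀ * misses G + R)         ∎
        where
        open ℚ.≤-Reasoning
        open +-*-Solver
        w₀ = weightℚ q G
        S = ∑ˡ (filter A? Gs) (weightℚ q)
        R = ∑ˡ Gs (λ G → weightℚ q G * misses G)

      -- First moment: `misses G` counts the members of `Ks` that share no edge with `G`. Its
      -- expectation is the sum of the (1 - q)^(e K) by `∑-miss`, after exchanging the sums over `G`
      -- and over `K`.
      union-bound : ∀ M → (∀ {K} → K ∈ˡ Ks → M ℕ.≤ e K) →
                    1ℚ ≤ ∑ˡ (filter A? (graphs n)) (weightℚ q) + fromℕ (length Ks) * (1ℚ - q) ^ M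
      union-bound M M≤e = begin
        1ℚ
          ≡⟨ ∑-weight n q ⟨
        ∑ˡ (graphs n) (weightℚ q)
          ≤⟨ ∑≤filter+bad (graphs n) ⟩
        good + ∑ˡ (graphs n) (λ G → weightℚ q G * misses G)
          ≡⟨ cong (good +_) (trans
               (∑ˡ-cong (graphs n) λ G → sym (∑ˡ-*ˡ (weightℚ q G) Ks (λ K → miss K G)))
               (∑ˡ-comm (graphs n) Ks (λ G K → weightℚ q G * miss K G))) ⟩
        good + ∑ˡ Ks (λ K → ∑ˡ (graphs n) (λ G → weightℚ q G * miss K G))
          ≡⟨ cong (good +_) (∑ˡ-cong Ks (∑-miss q)) ⟩
        good + ∑ˡ Ks (λ K → (1ℚ - q) ^ e K)
          ≤⟨ ℚ.+-monoʳ-≤ good (∑ˡ-mono Ks λ K∈ → ^-antimono 0≤1-q 1-q≤1 (M≤e K∈)) ⟩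
        good + ∑ˡ Ks (λ _ → (1ℚ - q) ^ M)
          ≡⟨ cong (good +_) (∑ˡ-const Ks ((1ℚ - q) ^ M)) ⟩
        good + fromℕ (length Ks) * (1ℚ - q) ^ M ∎
        where
        open ℚ.≤-Reasoning
        good : ℚ
        good = ∑ˡ (filter A? (graphs n)) (weightℚ q)

-- Complete bipartite graphs

-- Listing only the sets of size m matters: the union bound could not afford all 2^n subsets.
combos : ∀ n → ℕ → List (Subset n)
combos n       zero    = ⊥ ∷ []
combos zero    (suc m) = []
combos (suc n) (suc m) = map (true ∷_) (combos n m) ++ map (false ∷_) (combos n (suc m))

∣S∣≡0⇒S≡⊥ : (S : Subset n) → ∣ S ∣ ≡ 0 → S ≡ ⊥
∣S∣≡0⇒S≡⊥ []          _  = refl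
∣S∣≡0⇒S≡⊥ (false ∷ S) eq = cong (false ∷_) (∣S∣≡0⇒S≡⊥ S eq)

∈-combos : (S : Subset n) → ∀ m → ∣ S ∣ ≡ m → S ∈ˡ combos n m
∈-combos S           zero    eq = hereˡ (∣S∣≡0⇒S≡⊥ S eq)
∈-combos (true ∷ S)  (suc m) eq = ∈-++⁺ˡ (∈-map⁺ (true ∷_) (∈-combos S m (ℕ.suc-injective eq)))
∈-combos {suc n} (false ∷ S) (suc m) eq =
  ∈-++⁺ʳ (map (true ∷_) (combos n m)) (∈-map⁺ (false ∷_) (∈-combos S (suc m) eq))

-- Pascal's recursion, with (n+1)^m + (n+1)^(m+1) = (n+2)(n+1)^m.
length-combos : ∀ n m → length (combos n m) ℕ.≤ suc n ℕ.^ m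
length-combos n       zero    = ℕ.≤-refl
length-combos zero    (suc m) = ℕ.z≤n
length-combos (suc n) (suc m) = begin
  length (map (true ∷_) (combos n m) ++ map (false ∷_) (combos n (suc m)))
    ≡⟨ length-++ (map (true ∷_) (combos n m)) ⟩
  length (map (true ∷_) (combos n m)) ℕ.+ length (map (false ∷_) (combos n (suc m)))
    ≡⟨ cong₂ ℕ._+_ (length-map (true ∷_) (combos n m)) (length-map (false ∷_) (combos n (suc m))) ⟩
  length (combos n m) ℕ.+ length (combos n (suc m))
    ≤⟨ ℕ.+-mono-≤ (length-combos n m) (length-combos n (suc m)) ⟩
  suc (suc n) ℕ.* suc n ℕ.^ m
    ≤⟨ ℕ.*-monoʳ-≤ (suc (suc n)) (ℕ.^-monoˡ-≤ m (ℕ.n≤1+n (suc n))) ⟩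
  suc (suc n) ℕ.^ suc m ∎
  where open ℕ.≤-Reasoning

length-cartesianProductWith : ∀ (g : I → I′ → I″) xs ys →
  length (cartesianProductWith g xs ys) ≡ length xs ℕ.* length ys
length-cartesianProductWith g []       ys = refl
length-cartesianProductWith g (x ∷ xs) ys = trans (length-++ (map (g x) ys))
  (cong₂ ℕ._+_ (length-map (g x) ys) (length-cartesianProductWith g xs ys))

bipartite : Subset n → Subset n → Graph n
bipartite []          []          = []
bipartite (true ∷ X)  (_ ∷ Y)     = Y ∷ bipartite X Y
bipartite (false ∷ X) (true ∷ Y)  = X ∷ bipartite X Y
bipartite (false ∷ X) (false ∷ Y) = ⊥ ∷ bipartite X Y

Separated-tail : ∀ {s} {G : Graph n} {a b X Y} → Separated (s ∷ G) (a ∷ X) (b ∷ Y) → Separated G X Y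
Separated-tail sep x∈X y∈Y = let (x≢y , ¬xy) = sep (there x∈X) (there y∈Y) in x≢y ∘ cong suc , ¬xy

-- A first vertex in `X` adds a row of size `∣ Y ∣`, one in `Y` a row of size `∣ X ∣`, matching the
-- growth of the product; disjointness rules out a vertex in both.
e-bipartite : (G : Graph n) (X Y : Subset n) → Separated G X Y → e (bipartite X Y) ≡ ∣ X ∣ ℕ.* ∣ Y ∣
e-bipartite []      []          []          sep = refl
e-bipartite (s ∷ G) (true ∷ X)  (true ∷ Y)  sep = ⊥-elim (proj₁ (sep here here) refl)
e-bipartite (s ∷ G) (true ∷ X)  (false ∷ Y) sep =
  cong (∣ Y ∣ ℕ.+_) (e-bipartite G X Y (Separated-tail {s = s} {G} sep))
e-bipartite (s ∷ G) (false ∷ X) (true ∷ Y)  sep =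
  trans (cong (∣ X ∣ ℕ.+_) (e-bipartite G X Y (Separated-tail {s = s} {G} sep))) (sym (ℕ.*-suc ∣ X ∣ ∣ Y ∣))
e-bipartite {suc n} (s ∷ G) (false ∷ X) (false ∷ Y) sep =
  cong₂ ℕ._+_ (∣⊥∣≡0 n) (e-bipartite G X Y (Separated-tail {s = s} {G} sep))

miss-bipartite : (G : Graph n) (X Y : Subset n) → Separated G X Y → miss (bipartite X Y) G ≡ 1ℚ
miss-bipartite []      []          []          sep = refl
miss-bipartite (s ∷ G) (true ∷ X)  (_ ∷ Y)     sep = cong₂ _*_
  (missRow≡1 Y s λ i∈Y i∈s → proj₂ (sep here (there i∈Y)) (∈⇒T i∈s))
  (miss-bipartite G X Y (Separated-tail {s = s} {G} sep))
miss-bipartite (s ∷ G) (false ∷ X) (true ∷ Y)  sep = cong₂ _*_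
  (missRow≡1 X s λ i∈X i∈s → proj₂ (sep (there i∈X) here) (∈⇒T i∈s))
  (miss-bipartite G X Y (Separated-tail {s = s} {G} sep))
miss-bipartite (s ∷ G) (false ∷ X) (false ∷ Y) sep = cong₂ _*_
  (missRow≡1 ⊥ s λ i∈⊥ → ⊥-elim (∉⊥-Subset i∈⊥))
  (miss-bipartite G X Y (Separated-tail {s = s} {G} sep))

-- The filter discards overlapping pairs X, Y, for which bipartite X Y has fewer than m² edges.
bipartites : ∀ n → ℕ → List (Graph n)
bipartites n m = filter (λ K → m ℕ.* m ℕ.≤? e K) (cartesianProductWith bipartite (combos n m) (combos n m))

∈-bipartites : ∀ m (G : Graph n) X Y → ∣ X ∣ ≡ m → ∣ Y ∣ ≡ m → Separated G X Y →
               bipartite X Y ∈ˡ bipartites n m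
∈-bipartites m G X Y ∣X∣ ∣Y∣ sep = ∈-filter⁺ (λ K → m ℕ.* m ℕ.≤? e K)
  (∈-cartesianProductWith⁺ bipartite (∈-combos X m ∣X∣) (∈-combos Y m ∣Y∣))
  (ℕ.≤-reflexive (sym (trans (e-bipartite G X Y sep) (cong₂ ℕ._*_ ∣X∣ ∣Y∣))))

-- Counting the bipartite graphs

^ℕ-distrib-* : ∀ m a b → (a ℕ.* b) ℕ.^ m ≡ a ℕ.^ m ℕ.* b ℕ.^ m
^ℕ-distrib-* zero    a b = refl
^ℕ-distrib-* (suc m) a b = trans (cong (a ℕ.* b ℕ.*_) (^ℕ-distrib-* m a b))
  (ℕ.[m*n]*[o*p]≡[m*o]*[n*p] a b (a ℕ.^ m) (b ℕ.^ m))

-- Otherwise monotonicity of the logarithm would give 1 + ⌊log₂ n⌋ ≤ ⌊log₂ n⌋.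
n<2^[1+⌊log₂n⌋] : ∀ n → n ℕ.< 2 ℕ.^ suc ⌊log₂ n ⌋
n<2^[1+⌊log₂n⌋] n = ℕ.≰⇒> λ 2^≤n → ℕ.1+n≰n
  (subst (ℕ._≤ ⌊log₂ n ⌋) (⌊log₂[2^n]⌋≡n (suc ⌊log₂ n ⌋)) (⌊log₂⌋-mono-≤ 2^≤n))

-- With L = ⌊log₂ n⌋, the extra factor 2 in 1 + n ≤ 2 · 2^L is absorbed by another 2^L as L ≥ 1;
-- squaring 4^L gives the base 16.
[1+n]²≤16^⌊log₂n⌋ : ∀ n → 1 ℕ.≤ ⌊log₂ n ⌋ → suc n ℕ.* suc n ℕ.≤ 16 ℕ.^ ⌊log₂ n ⌋
[1+n]²≤16^⌊log₂n⌋ n 1≤L = begin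
  suc n ℕ.* suc n                     ≤⟨ ℕ.*-mono-≤ 1+n≤4^L 1+n≤4^L ⟩
  4 ℕ.^ L ℕ.* 4 ℕ.^ L                 ≡⟨ ^ℕ-distrib-* L 4 4 ⟨
  16 ℕ.^ L                            ∎
  where
  open ℕ.≤-Reasoning
  L = ⌊log₂ n ⌋
  1+n≤4^L : suc n ℕ.≤ 4 ℕ.^ L
  1+n≤4^L = begin
    suc n                  ≤⟨ n<2^[1+⌊log₂n⌋] n ⟩
    2 ℕ.^ suc L            ≤⟨ ℕ.*-monoˡ-≤ (2 ℕ.^ L) (ℕ.^-monoʳ-≤ 2 1≤L) ⟩
    2 ℕ.^ L ℕ.* 2 ℕ.^ L    ≡⟨ ^ℕ-distrib-* L 2 2 ⟨
    4 ℕ.^ L                ∎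

length-bipartites : ∀ n m → 1 ℕ.≤ ⌊log₂ n ⌋ → length (bipartites n m) ℕ.≤ (16 ℕ.^ ⌊log₂ n ⌋) ℕ.^ m
length-bipartites n m 1≤L = begin
  length (bipartites n m)
    ≤⟨ length-filter (λ K → m ℕ.* m ℕ.≤? e K) (cartesianProductWith bipartite (combos n m) (combos n m)) ⟩
  length (cartesianProductWith bipartite (combos n m) (combos n m))
    ≡⟨ length-cartesianProductWith bipartite (combos n m) (combos n m) ⟩
  length (combos n m) ℕ.* length (combos n m)
    ≤⟨ ℕ.*-mono-≤ (length-combos n m) (length-combos n m) ⟩
  suc n ℕ.^ m ℕ.* suc n ℕ.^ m
    ≡⟨ ^ℕ-distrib-* m (suc n) (suc n) ⟨
  (suc n ℕ.* suc n) ℕ.^ m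
    ≤⟨ ℕ.^-monoˡ-≤ m ([1+n]²≤16^⌊log₂n⌋ n 1≤L) ⟩
  (16 ℕ.^ ⌊log₂ n ⌋) ℕ.^ m ∎
  where open ℕ.≤-Reasoning

-- The constant comes from 16 · 1/32 = ½.
few-bad : ∀ {s} n c → 1 ℕ.≤ ⌊log₂ n ⌋ → 1 ℕ.≤ c → 0ℚ ≤ s → s ^ c ≤ ℤ.+ 1 ℚ./ 32 →
          let L = ⌊log₂ n ⌋ ; m = c ℕ.* L in
          fromℕ (length (bipartites n m)) * s ^ (m ℕ.* m) ≤ ½ ^ L
few-bad {s} n c 1≤L 1≤c 0≤s small = begin
  fromℕ (length (bipartites n m)) * s ^ (m ℕ.* m)
    ≤⟨ *-monoʳ (0≤^ (m ℕ.* m) 0≤s) (fromℕ-mono-≤ (length-bipartites n m 1≤L)) ⟩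
  fromℕ ((16 ℕ.^ L) ℕ.^ m) * s ^ (m ℕ.* m)
    ≡⟨ cong₂ _*_ (trans (fromℕ-^ (16 ℕ.^ L) m) (cong (_^ m) (fromℕ-^ 16 L)))
         (trans (sym (^-assocʳ s m m)) (cong (_^ m) (sym (^-assocʳ s c L)))) ⟩
  (fromℕ 16 ^ L) ^ m * ((s ^ c) ^ L) ^ m
    ≡⟨ ^-distrib-* (fromℕ 16 ^ L) ((s ^ c) ^ L) m ⟨
  (fromℕ 16 ^ L * (s ^ c) ^ L) ^ m
    ≡⟨ cong (_^ m) (^-distrib-* (fromℕ 16) (s ^ c) L) ⟨
  ((fromℕ 16 * s ^ c) ^ L) ^ m
    ≤⟨ ^-monoˡ m (0≤^ L 0≤16s^c) (^-monoˡ L 0≤16s^c (*-monoˡ (0≤fromℕ 16) small)) ⟩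
  (½ ^ L) ^ m
    ≤⟨ ^-antimono (0≤^ L 0≤½) (^≤1 L 0≤½ ½≤1) (ℕ.*-mono-≤ 1≤c 1≤L) ⟩
  (½ ^ L) ^ 1
    ≡⟨ ℚ.*-identityʳ (½ ^ L) ⟩
  ½ ^ L ∎
  where
  open ℚ.≤-Reasoning
  L = ⌊log₂ n ⌋
  m = c ℕ.* L
  0≤16s^c = 0≤* (0≤fromℕ 16) (0≤^ c 0≤s)

-- The saturation number

-- A smallest saturated subgraph exists because `F` has an edge. Every missing edge of `G` satisfies
-- `w≤-of-new-copy`, whose `suc` is what `w F ℕ.∸ 1` removes.
sat-bound : (F : Graph k) → HasEdge F → (G : Graph n) → ∀ m → let W = w F ℕ.∸ 1 in
            W ℕ.* n ℕ.≤ 2 ℕ.* sat G F ℕ.+ W ℕ.* ((m ℕ.+ W ℕ.* m) ℕ.+ m) ⊎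
            ∃₂ λ X Y → ∣ X ∣ ≡ m × ∣ Y ∣ ≡ m × Separated G X Y
sat-bound F edge G m with sat-attained F edge G
... | H , (_ , free , new-copy) , sat≡ rewrite sat≡ = edge-bound-or-separated G H (w F ℕ.∸ 1)
  (λ x y xy∈G xy∉H → ℕ.∸-monoˡ-≤ 1 (w≤-of-new-copy F H free x y (new-copy x y xy∈G xy∉H))) m

-- Truncated subtraction is avoided by passing through v n ≤ n + (v ∸ 1) n, which also holds for v =
-- 0. Halving the hypothesis leaves half of the error term to spare.
ℚ-bound : ∀ v n C L S → (v ℕ.∸ 1) ℕ.* n ℕ.≤ 2 ℕ.* S ℕ.+ C ℕ.* L →
          ((fromℕ v - 1ℚ) * ½) * fromℕ n - fromℕ C * fromℕ L ≤ fromℕ S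
ℚ-bound v n C L S h = begin
  ((V - 1ℚ) * ½) * M - K            ≡⟨ expand V M K ⟩
  ½ * (V * M) - (½ * M + K)         ≤⟨ ℚ.+-monoˡ-≤ (- (½ * M + K)) (*-monoˡ 0≤½ V*M≤) ⟩
  ½ * (M + (fromℕ 2 * fromℕ S + K)) - (½ * M + K)  ≡⟨ collect M (fromℕ S) K ⟩
  fromℕ S - ½ * K
    ≤⟨ ℚ.+-monoʳ-≤ (fromℕ S) (ℚ.neg-antimono-≤ (0≤* 0≤½ (0≤* (0≤fromℕ C) (0≤fromℕ L)))) ⟩
  fromℕ S - 0ℚ                      ≡⟨ ℚ.+-identityʳ (fromℕ S) ⟩
  fromℕ S                           ∎
  where
  open ℚ.≤-Reasoning
  V M K : ℚ
  V = fromℕ v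
  M = fromℕ n
  K = fromℕ C * fromℕ L
  v*n≤ : v ℕ.* n ℕ.≤ n ℕ.+ (2 ℕ.* S ℕ.+ C ℕ.* L)
  v*n≤ = ℕ.≤-trans (ℕ.*-monoˡ-≤ n (ℕ.m≤n+m∸n v 1)) (ℕ.+-monoʳ-≤ n h)
  V*M≤ : V * M ≤ M + (fromℕ 2 * fromℕ S + K)
  V*M≤ = subst₂ _≤_ (fromℕ-* v n)
    (trans (fromℕ-+ n _) (cong (M +_)
      (trans (fromℕ-+ (2 ℕ.* S) (C ℕ.* L)) (cong₂ _+_ (fromℕ-* 2 S) (fromℕ-* C L)))))
    (fromℕ-mono-≤ v*n≤)
  open +-*-Solver
  expand : ∀ V M K → ((V - 1ℚ) * ½) * M - K ≡ ½ * (V * M) - (½ * M + K)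
  expand = solve 3 (λ V M K → ((V :- con 1ℚ) :* con ½) :* M :- K
                              := con ½ :* (V :* M) :- (con ½ :* M :+ K)) refl
  collect : ∀ M S K → ½ * (M + (fromℕ 2 * S + K)) - (½ * M + K) ≡ S - ½ * K
  collect = solve 3 (λ M S K → con ½ :* (M :+ (con (fromℕ 2) :* S :+ K)) :- (con ½ :* M :+ K)
                               := S :- con ½ :* K) refl

-- For m = c ⌊log₂ n⌋ the error term of sat-bound is loss F c * ⌊log₂ n⌋.
loss : Graph k → ℕ → ℕ
loss F c = let W = w F ℕ.∸ 1 in (W ℕ.* (2 ℕ.+ W)) ℕ.* c

SatBound : Graph k → ℕ → ∀ n → Graph n → Set
SatBound F C n G = ((fromℕ (w F) - 1ℚ) * ½) * fromℕ n - fromℕ C * fromℕ ⌊log₂ n ⌋ ≤ fromℕ (sat G F)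

satBound? : (F : Graph k) (C : ℕ) → ∀ n → Decidable (SatBound F C n)
satBound? F C n G = ((fromℕ (w F) - 1ℚ) * ½) * fromℕ n - fromℕ C * fromℕ ⌊log₂ n ⌋ ≤? fromℕ (sat G F)

bad-graph : (F : Graph k) → HasEdge F → ∀ c (G : Graph n) → ¬ SatBound F (loss F c) n G →
            ∃ λ K → K ∈ˡ bipartites n (c ℕ.* ⌊log₂ n ⌋) × miss K G ≡ 1ℚ
bad-graph {n = n} F edge c G ¬bound =
  [ (λ h → ⊥-elim (¬bound (ℚ-bound (w F) n (loss F c) L (sat G F)
      (ℕ.≤-trans h (ℕ.≤-reflexive (cong (2 ℕ.* sat G F ℕ.+_) (regroup (w F ℕ.∸ 1) c L)))))))
  , (λ (X , Y , ∣X∣ , ∣Y∣ , sep) →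
      bipartite X Y , ∈-bipartites (c ℕ.* L) G X Y ∣X∣ ∣Y∣ sep , miss-bipartite G X Y sep)
  ]′ (sat-bound F edge G (c ℕ.* L))
  where
  L = ⌊log₂ n ⌋
  regroup : ∀ W c L → W ℕ.* ((c ℕ.* L ℕ.+ W ℕ.* (c ℕ.* L)) ℕ.+ c ℕ.* L) ≡ ((W ℕ.* (2 ℕ.+ W)) ℕ.* c) ℕ.* L
  regroup = solve 3 (λ W c L → W :* ((c :* L :+ W :* (c :* L)) :+ c :* L)
                               := ((W :* (con 2 :+ W)) :* c) :* L) refl
    where open ℕ-Solver.+-*-Solver

-- Convergence of the probability to 1

⟶1 : (x : ℕ → ℝ) (I : ℕ) →
     (∀ n i → 1 ℕ.≤ ⌊log₂ n ⌋ → I ℕ.≤ i → seq (x n) i ≤ 1ℚ × 1ℚ ≤ seq (x n) i + ½ ^ ⌊log₂ n ⌋) →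
     x ⟶ 1ℝ
⟶1 x I bounds ε (δ , 0<δ , I′ , δ≤ε) =
  -- The gap `δ` below `ε` is halved: one half bounds ½^⌊log₂ n⌋, where ½ appears as `1ℚ - ½`, and
  -- the other witnesses the strict inequality.
  let (J , vanish) = ^-vanishes (ℚ.positive⁻¹ ½) ½≤1 0<½δ
  -- The exponent `suc J` in place of `J` also makes ⌊log₂ n⌋ positive, as `bounds` demands.
  in 2 ℕ.^ suc J , λ n 2^≤n → ½ * δ , 0<½δ , I ℕ.⊔ I′ , λ i ≤i →
    let 1+J≤L = subst (ℕ._≤ ⌊log₂ n ⌋) (⌊log₂[2^n]⌋≡n (suc J)) (⌊log₂⌋-mono-≤ 2^≤n)
        (x≤1 , 1≤x+) = bounds n i (ℕ.≤-trans (ℕ.s≤s ℕ.z≤n) 1+J≤L) (ℕ.m⊔n≤o⇒m≤o I I′ ≤i)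
    in close (seq (x n) i) x≤1
         (ℚ.≤-trans 1≤x+ (ℚ.+-monoʳ-≤ (seq (x n) i) (vanish ⌊log₂ n ⌋ (ℕ.<⇒≤ 1+J≤L))))
         (δ≤ε i (ℕ.m⊔n≤o⇒n≤o I I′ ≤i))
  where
  open ℚ.≤-Reasoning
  open +-*-Solver
  0<½δ : 0ℚ < ½ * δ
  0<½δ = ℚ.*-monoʳ-<-pos ½ 0<δ

  close : ∀ y {z} → y ≤ 1ℚ → 1ℚ ≤ y + ½ * δ → 0ℚ + δ ≤ z → ℚ.∣ y - 1ℚ ∣ + ½ * δ ≤ z
  close y {z} y≤1 1≤y+ δ≤z = begin
    ℚ.∣ y - 1ℚ ∣ + ½ * δ          ≡⟨ cong (_+ ½ * δ) ∣y-1∣ ⟩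
    (1ℚ - y) + ½ * δ              ≤⟨ ℚ.+-monoˡ-≤ (½ * δ) (ℚ.+-monoˡ-≤ (- y) 1≤y+) ⟩
    ((y + ½ * δ) - y) + ½ * δ     ≡⟨ solve 2 (λ y δ → ((y :+ con ½ :* δ) :- y) :+ con ½ :* δ := con 0ℚ :+ δ) refl y δ ⟩
    0ℚ + δ                        ≤⟨ δ≤z ⟩
    z                             ∎
    where
    ∣y-1∣ : ℚ.∣ y - 1ℚ ∣ ≡ 1ℚ - y
    ∣y-1∣ = trans (cong ℚ.∣_∣ (solve 1 (λ y → y :- con 1ℚ := :- (con 1ℚ :- y)) refl y))
      (trans (ℚ.∣-p∣≡∣p∣ (1ℚ - y)) (ℚ.0≤p⇒∣p∣≡p (p≤q⇒0≤q-p y≤1)))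

ℙ-bounds : ∀ {q} → 0ℚ ≤ q → q ≤ 1ℚ → ∀ c → 1 ℕ.≤ c → (1ℚ - q) ^ c ≤ ℤ.+ 1 ℚ./ 32 →
           ∀ n → 1 ℕ.≤ ⌊log₂ n ⌋ → {A : Graph n → Set} (A? : Decidable A) →
           (∀ G → ¬ A G → ∃ λ K → K ∈ˡ bipartites n (c ℕ.* ⌊log₂ n ⌋) × miss K G ≡ 1ℚ) →
           let P = ∑ˡ (filter A? (graphs n)) (weightℚ q) in P ≤ 1ℚ × 1ℚ ≤ P + ½ ^ ⌊log₂ n ⌋
ℙ-bounds {q} 0≤q q≤1 c 1≤c small n 1≤L A? bad = ℙ≤1 A? , (begin
  1ℚ
    ≤⟨ union-bound A? (bipartites n m) bad (m ℕ.* m) (proj₂ ∘ ∈-filter⁻ (λ K → m ℕ.* m ℕ.≤? e K)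
         {xs = cartesianProductWith bipartite (combos n m) (combos n m)}) ⟩
  P + fromℕ (length (bipartites n m)) * (1ℚ - q) ^ (m ℕ.* m)
    ≤⟨ ℚ.+-monoʳ-≤ P (few-bad n c 1≤L 1≤c (p≤q⇒0≤q-p q≤1) small) ⟩
  P + ½ ^ ⌊log₂ n ⌋ ∎)
  where
  open ℚ.≤-Reasoning
  open Probability 0≤q (p≤q⇒0≤q-p q≤1) (1-p≤1 0≤q)
  m = c ℕ.* ⌊log₂ n ⌋
  P = ∑ˡ (filter A? (graphs n)) (weightℚ q)

whp-SatBound : ∀ p {a} I → (∀ i → I ℕ.≤ i → a ≤ seq p i × seq p i ≤ 1ℚ) → 0ℚ ≤ a →
               ∀ c → 1 ℕ.≤ c → (1ℚ - a) ^ c ≤ ℤ.+ 1 ℚ./ 32 → (F : Graph k) → HasEdge F →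
               WithHighProbability p (satBound? F (loss F c))
whp-SatBound p {a} I bounds 0≤a c 1≤c small F edge =
  ⟶1 (λ n → ℙ p (satBound? F (loss F c) n)) I λ n i 1≤L I≤i →
  let (a≤q , q≤1) = bounds i I≤i
      0≤q = ℚ.≤-trans 0≤a a≤q
      -- Since 1 - q ≤ 1 - a, the exponent `c` chosen for the lower bound `a` serves every
      -- approximation of `p` from index `I` on.
      small′ = ℚ.≤-trans (^-monoˡ c (p≤q⇒0≤q-p q≤1) (ℚ.+-monoʳ-≤ 1ℚ (ℚ.neg-antimono-≤ a≤q))) small
  in subst (λ P → P ≤ 1ℚ × 1ℚ ≤ P + ½ ^ ⌊log₂ n ⌋)
       (sym (seq-∑ℝ p i (filter (satBound? F (loss F c) n) (graphs n))))
       (ℙ-bounds 0≤q q≤1 c 1≤c small′ n 1≤L (satBound? F (loss F c) n) (bad-graph F edge c))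

theorem3p4 : (p : ℝ) → 0ℝ <ℝ p → p <ℝ 1ℝ →
    ∀ {k : ℕ} (F : Graph k) → HasEdge F →
    ∃ λ (C : ℕ) → WithHighProbability p (λ n G →
    ((fromℕ (w F) - 1ℚ) * ½) * fromℕ n - fromℕ C * fromℕ ⌊log₂ n ⌋ ≤? fromℕ (sat G F))
theorem3p4 p (a , 0<a , N₁ , a≤p) (b , 0<b , N₂ , p+b≤1) F edge =
  -- The rational `a` that separates `p` from 0 bounds the approximations from below eventually;
  -- 1/32 is the threshold of `few-bad`.
  let (c , small) = ^-vanishes 0<a a≤1 (ℚ.positive⁻¹ (ℤ.+ 1 ℚ./ 32))
  -- Taking `suc c` ensures the positive factor that `few-bad` requires.
  in loss F (suc c) ,
     whp-SatBound p (N₁ ℕ.⊔ N₂)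
       (λ i ≤i → a≤pᵢ i (ℕ.m⊔n≤o⇒m≤o N₁ N₂ ≤i) , pᵢ≤1 i (ℕ.m⊔n≤o⇒n≤o N₁ N₂ ≤i))
       (ℚ.<⇒≤ 0<a) (suc c) (ℕ.s≤s ℕ.z≤n) (small (suc c) (ℕ.n≤1+n c)) F edge
  where
  open ℚ.≤-Reasoning

  a≤pᵢ : ∀ i → N₁ ℕ.≤ i → a ≤ seq p i
  a≤pᵢ i N₁≤i = subst (_≤ seq p i) (ℚ.+-identityˡ a) (a≤p i N₁≤i)

  pᵢ≤1 : ∀ i → N₂ ℕ.≤ i → seq p i ≤ 1ℚ
  pᵢ≤1 i N₂≤i = begin
    seq p i        ≡⟨ ℚ.+-identityʳ (seq p i) ⟨
    seq p i + 0ℚ   ≤⟨ ℚ.+-monoʳ-≤ (seq p i) (ℚ.<⇒≤ 0<b) ⟩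
    seq p i + b    ≤⟨ p+b≤1 i N₂≤i ⟩
    1ℚ             ∎

  a≤1 : a ≤ 1ℚ
  a≤1 = ℚ.≤-trans (a≤pᵢ _ (ℕ.m≤m⊔n N₁ N₂)) (pᵢ≤1 _ (ℕ.m≤n⊔m N₁ N₂))
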